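{- For all integers $m,i$ with $1\leq i\leq m-1$, $$\frac{d_{i-1}^{2}(m)-d_{i-2}(m)d_{i}(m)}{d_{i}^{2}(m)-d_{i-1}(m)d_{i+1}(m)} < \frac{(i+1)(i+2)(m+i+3)^2}{(m+1-i)(m+2-i)(m+i+2)^{2}}.$$
   Context: For integers $m\ge 0$ and $0\le i\le m$, the Boros-Moll numbers are $$d_i(m)=2^{ -2m}\sum_{k=i}^m 2^k\binom{2m-2k}{m-k}\binom{m+k}{k}\binom{k}{i},$$ with the convention $d_i(m)=0$ for $i<0$ or $i>m$. The notation $d_i^{2}(m)$ means $(d_i(m))^2$. -}

module Defs where

open import Data.Nat using (ℕ; suc; _+_; _*_; _∸_; _^_)
open import Data.Nat.Properties using (m^n≢0)
open import Data.Nat.Combinatorics using (_C_)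
open import Data.Nat.ListAction using (sum)
open import Data.List using (applyUpTo)
open import Data.Integer using (ℤ; +_; -[1+_])
open import Data.Rational as ℚ using (ℚ; 0ℚ)

-- f a + f (a + 1) + … + f b, which is 0 when b < a.
∑[_⋯_] : ℕ → ℕ → (ℕ → ℕ) → ℕ
∑[ a ⋯ b ] f = sum (applyUpTo (λ j → f (a + j)) (suc b ∸ a))

-- d i m is the Boros–Moll number dᵢ(m).  The truncated subtractions are exact
-- because k ≤ m throughout the range of summation; for i > m that range is
-- empty, so d i m = 0.
d : ℤ → ℕ → ℚ
d (+ i) m =
  ((+ ∑[ i ⋯ m ] λ k →
      2 ^ k * ((2 * m ∸ 2 * k) C (m ∸ k)) * ((m + k) C k) * (k C i))
   ℚ./ (2 ^ (2 * m))) {{m^n≢0 2 (2 * m)}}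
d -[1+ _ ] m = 0ℚ

infix 9 _²
_² : ℚ → ℚ
p ² = p ℚ.* p

fromℤ : ℤ → ℚ
fromℤ z = z ℚ./ 1

{-# OPTIONS --safe #-}
module Submission where

open import Defs
open import Data.Nat using (ℕ)
open import Data.Integer as ℤ using (ℤ; +_)
open import Data.Rational as ℚ using (ℚ)
open import Data.Product using (Σ-syntax)

import Algebra.Properties.Group as Group
open import Data.Integer using (+[1+_]; -[1+_])
import Data.Integer.Properties as ℤ
import Data.Integer.Tactic.RingSolver as ℤSolver
open import Data.List using (List; []; _∷_; applyUpTo)
open import Data.Nat using (zero; suc; _+_; _*_; _∸_; _^_; _≤_; _<_; z≤n; s≤s; NonZero)
open import Data.Nat.Combinatorics
  using (_C_; nC1≡n; nCn≡1; nCk≡nC[n∸k]; k>n⇒nCk≡0; nCk+nC[k+1]≡[n+1]C[k+1])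
open import Data.Nat.ListAction using (sum)
import Data.Nat.Properties as ℕ
import Data.Nat.Tactic.RingSolver as ℕSolver
open import Data.Product using (_×_; _,_; proj₁; proj₂)
open import Data.Rational using (0ℚ; 1ℚ)
import Data.Rational.Properties as ℚ
import Data.Rational.Solver as ℚSolver
open import Data.Rational.Unnormalised as ℚᵘ using (mkℚᵘ; *≡*)
import Data.Rational.Unnormalised.Properties as ℚᵘ
open import Data.Sum using (_⊎_; inj₁; inj₂)
open import Relation.Binary.PropositionalEquality

-- Creative telescoping gives a three-term recurrence in i for dᵢ(m).  It turns
-- the numerator and the denominator into quadratic forms in A = dᵢ₋₁(m) and
-- B = dᵢ(m).  With a = m + 1 - i and Z = a A - i B, descending induction on i
-- confines Z to the cone  i² B ≤ 2 (i² + a - 1) Z,  2 Z ≤ B;  inside it the form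
-- deciding the inequality is a combination of α = 2 (i² + a - 1) Z - i² B and
-- β = B - 2 Z whose coefficients are polynomials in i - 1 and m - 1 - i with
-- nonnegative coefficients.

-- The recurrence

-- Both walls of the cone are needed. At i = m - 1 and Z = 0 the deciding form is a negative
-- multiple of B² once i is large, so Z ≥ 0 does not suffice; and the lower wall survives the
-- induction only together with the upper one. At i = m, where a = 1, the cone shrinks to the ray 2
-- Z = B, and the true values lie on it, so both bounds are sharp there. As linear forms in B and Z,
-- α and β have determinant 2 (a - 1) up to sign. Multiplying the deciding form by 2 (a - 1)
-- therefore clears all denominators when B and Z are expressed through α and β. Its Z² term is kept
-- apart and (a - 1) B² is set aside for strictness. What is left is B times a linear form, whose
-- coefficients in α and β are then uniquely determined; these are the large polynomials tabulated
-- below.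

C-absorption : ∀ n k → suc k * (suc n C suc k) ≡ suc n * (n C k)
C-absorption zero    zero    = refl
C-absorption zero    (suc k) = begin
  suc (suc k) * (1 C suc (suc k)) ≡⟨ cong (suc (suc k) *_) (k>n⇒nCk≡0 {n = 1} {suc (suc k)} (s≤s (s≤s z≤n))) ⟩
  suc (suc k) * 0                 ≡⟨ ℕ.*-zeroʳ (suc (suc k)) ⟩
  0                               ≡⟨ cong (1 *_) (k>n⇒nCk≡0 {n = 0} {suc k} (s≤s z≤n)) ⟨
  1 * (0 C suc k)                 ∎
  where open ≡-Reasoning
C-absorption (suc n) zero    = begin
  1 * (suc (suc n) C 1)  ≡⟨ cong (1 *_) (nC1≡n (suc (suc n))) ⟩
  1 * suc (suc n)        ≡⟨ ℕ.*-comm 1 (suc (suc n)) ⟩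
  suc (suc n) * 1        ≡⟨⟩
  suc (suc n) * (suc n C 0) ∎
  where open ≡-Reasoning
C-absorption (suc n) (suc k) = begin
  suc (suc k) * (suc (suc n) C suc (suc k))
    ≡⟨ cong (suc (suc k) *_) (nCk+nC[k+1]≡[n+1]C[k+1] (suc n) (suc k)) ⟨
  suc (suc k) * (x + (suc n C suc (suc k)))
    ≡⟨ ℕ.*-distribˡ-+ (suc (suc k)) x _ ⟩
  (x + suc k * x) + suc (suc k) * (suc n C suc (suc k))
    ≡⟨ cong₂ (λ y z → (x + y) + z) (C-absorption n k) (C-absorption n (suc k)) ⟩
  (x + suc n * (n C k)) + suc n * (n C suc k)
    ≡⟨ ℕ.+-assoc x _ _ ⟩
  x + (suc n * (n C k) + suc n * (n C suc k))
    ≡⟨ cong (_+_ x) (ℕ.*-distribˡ-+ (suc n) (n C k) (n C suc k)) ⟨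
  x + suc n * ((n C k) + (n C suc k))
    ≡⟨ cong (λ y → x + suc n * y) (nCk+nC[k+1]≡[n+1]C[k+1] n k) ⟩
  suc (suc n) * x ∎
  where
  open ≡-Reasoning
  x = suc n C suc k

-- Absorption minus Pascal's rule. Keeping k C(n, k) on the left avoids the truncated difference n -
-- k, so the identity also covers k > n.
C-shift : ∀ n k → suc k * (n C suc k) + k * (n C k) ≡ n * (n C k)
C-shift n k = ℕ.+-cancelˡ-≡ (n C k) _ _ (begin
  x + (suc k * y + k * x)  ≡⟨ ring x y k ⟩
  suc k * (x + y)          ≡⟨ cong (suc k *_) (nCk+nC[k+1]≡[n+1]C[k+1] n k) ⟩
  suc k * (suc n C suc k)  ≡⟨ C-absorption n k ⟩
  x + n * x                ∎)
  where
  open ≡-Reasoning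
  x = n C k
  y = n C suc k
  ring : ∀ x y k → x + (suc k * y + k * x) ≡ suc k * (x + y)
  ring = ℕSolver.solve-∀

centralC : ℕ → ℕ
centralC p = (2 * p) C p

-- Two absorptions lower 2p + 2 to 2p; between them the symmetry of row 2p + 1 raises the lower
-- index from p back to p + 1, where the second one applies.
centralC-suc : ∀ p → suc p * centralC (suc p) ≡ 2 * (suc (2 * p) * centralC p)
centralC-suc p = begin
  suc p * ((2 * suc p) C suc p)           ≡⟨ cong (λ n → suc p * (n C suc p)) (2*suc p) ⟩
  suc p * (suc (suc (2 * p)) C suc p)     ≡⟨ C-absorption (suc (2 * p)) p ⟩
  suc (suc (2 * p)) * (suc (2 * p) C p)   ≡⟨ cong (suc (suc (2 * p)) *_) sym-C ⟩
  suc (suc (2 * p)) * (suc (2 * p) C suc p) ≡⟨ ring p (suc (2 * p) C suc p) ⟩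
  2 * (suc p * (suc (2 * p) C suc p))     ≡⟨ cong (2 *_) (C-absorption (2 * p) p) ⟩
  2 * (suc (2 * p) * centralC p)          ∎
  where
  open ≡-Reasoning
  2*suc : ∀ p → 2 * suc p ≡ suc (suc (2 * p))
  2*suc = ℕSolver.solve-∀
  ring : ∀ p x → suc (suc (2 * p)) * x ≡ 2 * (suc p * x)
  ring = ℕSolver.solve-∀
  split : ∀ p → suc (2 * p) ≡ p + suc p
  split = ℕSolver.solve-∀
  sym-C : suc (2 * p) C p ≡ suc (2 * p) C suc p
  sym-C = trans
    (nCk≡nC[n∸k] (subst (p ≤_) (sym (split p)) (ℕ.m≤m+n p (suc p))))
    (cong (suc (2 * p) C_) (trans (cong (_∸ p) (split p)) (ℕ.m+n∸m≡n p (suc p))))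

-- The part of the summand of dᵢ(m) that is independent of i, hence shared by three consecutive
-- values of i.
coeff : ℕ → ℕ → ℕ
coeff m k = 2 ^ k * ((2 * m ∸ 2 * k) C (m ∸ k)) * ((m + k) C k)

coeff-+ : ∀ p k → coeff (p + k) k ≡ 2 ^ k * centralC p * ((p + k + k) C k)
coeff-+ p k = cong (λ x → 2 ^ k * x * ((p + k + k) C k))
  (cong₂ _C_ (trans (sym (ℕ.*-distribˡ-∸ 2 (p + k) k)) (cong (2 *_) p+k∸k)) p+k∸k)
  where
  p+k∸k : p + k ∸ k ≡ p
  p+k∸k = ℕ.m+n∸n≡m p k

-- The hypergeometric term ratio in k, cross-multiplied, with p = m - k - 1. The extra 2 from the
-- power of two is the one that `centralC-suc` consumes.
coeff-suc : ∀ p k → let m = suc p + k in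
            suc k * suc (2 * p) * coeff m (suc k) ≡ suc (m + k) * suc p * coeff m k
coeff-suc p k = begin
  suc k * suc (2 * p) * coeff m (suc k)
    ≡⟨ cong (λ n → suc k * suc (2 * p) * coeff n (suc k)) (ℕ.+-suc p k) ⟨
  suc k * suc (2 * p) * coeff (p + suc k) (suc k)
    ≡⟨ cong (suc k * suc (2 * p) *_) (coeff-+ p (suc k)) ⟩
  suc k * suc (2 * p) * (2 * 2 ^ k * centralC p * ((p + suc k + suc k) C suc k))
    ≡⟨ cong (λ n → suc k * suc (2 * p) * (2 * 2 ^ k * centralC p * (n C suc k))) (index p k) ⟩
  suc k * suc (2 * p) * (2 * 2 ^ k * centralC p * (suc (m + k) C suc k))
    ≡⟨ ring₁ (suc k) (suc (2 * p)) (2 ^ k) (centralC p) _ ⟩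
  2 ^ k * (2 * (suc (2 * p) * centralC p)) * (suc k * (suc (m + k) C suc k))
    ≡⟨ cong₂ (λ x y → 2 ^ k * x * y) (sym (centralC-suc p)) (C-absorption (m + k) k) ⟩
  2 ^ k * (suc p * centralC (suc p)) * (suc (m + k) * ((m + k) C k))
    ≡⟨ ring₂ (suc p) (suc (m + k)) (2 ^ k) (centralC (suc p)) _ ⟩
  suc (m + k) * suc p * (2 ^ k * centralC (suc p) * ((m + k) C k))
    ≡⟨ cong (suc (m + k) * suc p *_) (coeff-+ (suc p) k) ⟨
  suc (m + k) * suc p * coeff m k ∎
  where
  open ≡-Reasoning
  m = suc p + k
  index : ∀ p k → p + suc k + suc k ≡ suc (suc p + k + k)
  index = ℕSolver.solve-∀
  ring₁ : ∀ k p e c x → k * p * (2 * e * c * x) ≡ e * (2 * (p * c)) * (k * x)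
  ring₁ = ℕSolver.solve-∀
  ring₂ : ∀ p m e c x → e * (p * c) * (m * x) ≡ m * p * (e * c * x)
  ring₂ = ℕSolver.solve-∀

-- Splits off the last term, unlike the list sum behind `∑[_⋯_]`, as induction along partial sums
-- requires.
Σ< : ℕ → (ℕ → ℕ) → ℕ
Σ< zero    f = 0
Σ< (suc n) f = Σ< n f + f n

Σ<-zero : ∀ n f → (∀ k → k < n → f k ≡ 0) → Σ< n f ≡ 0
Σ<-zero zero    f f≡0 = refl
Σ<-zero (suc n) f f≡0 =
  cong₂ _+_ (Σ<-zero n f (λ k k<n → f≡0 k (ℕ.m<n⇒m<1+n k<n))) (f≡0 n (ℕ.n<1+n n))

Σ<-+ : ∀ m n f → Σ< (m + n) f ≡ Σ< m f + Σ< n (λ k → f (m + k))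
Σ<-+ m zero    f = trans (cong (λ k → Σ< k f) (ℕ.+-identityʳ m)) (sym (ℕ.+-identityʳ _))
Σ<-+ m (suc n) f = begin
  Σ< (m + suc n) f                             ≡⟨ cong (λ k → Σ< k f) (ℕ.+-suc m n) ⟩
  Σ< (m + n) f + f (m + n)                     ≡⟨ cong (_+ f (m + n)) (Σ<-+ m n f) ⟩
  Σ< m f + Σ< n (λ k → f (m + k)) + f (m + n)  ≡⟨ ℕ.+-assoc (Σ< m f) _ _ ⟩
  Σ< m f + Σ< (suc n) (λ k → f (m + k))        ∎
  where open ≡-Reasoning

sum-applyUpTo : ∀ f n → sum (applyUpTo f n) ≡ Σ< n f
sum-applyUpTo f zero    = refl
sum-applyUpTo f (suc n) =
  trans (cong (_+_ (f 0)) (sum-applyUpTo (λ k → f (suc k)) n)) (sym (Σ<-+ 1 n f))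

-- Extending the sums down to 0 gives the three sums of the recurrence one common range, so that
-- they can be combined term by term.
∑-Σ< : ∀ a b f → (∀ k → k < a → f k ≡ 0) → ∑[ a ⋯ b ] f ≡ Σ< (suc b) f
∑-Σ< a b f f≡0 = trans (sum-applyUpTo (λ k → f (a + k)) (suc b ∸ a)) (shifted (ℕ.≤-total a (suc b)))
  where
  shifted : (a ≤ suc b) ⊎ (suc b ≤ a) → Σ< (suc b ∸ a) (λ k → f (a + k)) ≡ Σ< (suc b) f
  shifted (inj₁ a≤1+b) = begin
    Σ< (suc b ∸ a) (λ k → f (a + k))           ≡⟨ cong (_+ Σ< (suc b ∸ a) (λ k → f (a + k))) (Σ<-zero a f f≡0) ⟨
    Σ< a f + Σ< (suc b ∸ a) (λ k → f (a + k))  ≡⟨ Σ<-+ a (suc b ∸ a) f ⟨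
    Σ< (a + (suc b ∸ a)) f                     ≡⟨ cong (λ k → Σ< k f) (ℕ.m+[n∸m]≡n a≤1+b) ⟩
    Σ< (suc b) f                               ∎
    where open ≡-Reasoning
  shifted (inj₂ 1+b≤a) = begin
    Σ< (suc b ∸ a) (λ k → f (a + k))  ≡⟨ cong (λ n → Σ< n (λ k → f (a + k))) (ℕ.m≤n⇒m∸n≡0 1+b≤a) ⟩
    0                                 ≡⟨ Σ<-zero (suc b) f (λ k k≤b → f≡0 k (ℕ.≤-trans k≤b 1+b≤a)) ⟨
    Σ< (suc b) f                      ∎
    where open ≡-Reasoning

-- bm i m = 4 ^ m * dᵢ(m)
bm : ℕ → ℕ → ℕ
bm i m = ∑[ i ⋯ m ] λ k → 2 ^ k * ((2 * m ∸ 2 * k) C (m ∸ k)) * ((m + k) C k) * (k C i)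

partial : ℕ → ℕ → ℕ → ℕ
partial m i n = Σ< n (λ k → coeff m k * (k C i))

bm-partial : ∀ m i → bm i m ≡ partial m i (suc m)
bm-partial m i = ∑-Σ< i m _ (λ k k<i →
  trans (cong (coeff m k *_) (k>n⇒nCk≡0 k<i)) (ℕ.*-zeroʳ (coeff m k)))

-- The k-th term of the telescoping sum divided by coeff m k; here b₀, b₁, b₂ stand
-- for C(k, j), C(k, j+1), C(k, j+2) and p for m - k.
summand : ∀ j k p b₀ b₁ b₂ → let m = p ℤ.+ k in
  (+ 1 ℤ.+ j) ℤ.* b₁ ℤ.+ j ℤ.* b₀ ≡ k ℤ.* b₀ →
  (+ 2 ℤ.+ j) ℤ.* b₂ ℤ.+ (+ 1 ℤ.+ j) ℤ.* b₁ ≡ k ℤ.* b₁ →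
  (m ℤ.- j) ℤ.* (+ 1 ℤ.+ m ℤ.+ j) ℤ.* b₀ ℤ.+ (+ 1 ℤ.+ j) ℤ.* (+ 2 ℤ.+ j) ℤ.* b₂
    ℤ.+ (+ 1 ℤ.+ j) ℤ.* (+ 1 ℤ.+ + 2 ℤ.* p) ℤ.* b₁
  ≡ (+ 1 ℤ.+ j) ℤ.* (+ 1 ℤ.+ + 2 ℤ.* m) ℤ.* b₁ ℤ.+ (+ 1 ℤ.+ m ℤ.+ k) ℤ.* p ℤ.* b₀
summand j k p b₀ b₁ b₂ eq₁ eq₂ = ℤ.i-j≡0⇒i≡j _ _ (trans (ring j k p b₀ b₁ b₂)
  (trans (cong₂ (λ x y → (j ℤ.+ + 1) ℤ.* x ℤ.- (k ℤ.+ j ℤ.+ + 1) ℤ.* y)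
     (ℤ.i≡j⇒i-j≡0 eq₂) (ℤ.i≡j⇒i-j≡0 eq₁)) (zero-combination j k)))
  where
  zero-combination : ∀ j k → (j ℤ.+ + 1) ℤ.* + 0 ℤ.- (k ℤ.+ j ℤ.+ + 1) ℤ.* + 0 ≡ + 0
  zero-combination = ℤSolver.solve-∀
  ring : ∀ j k p b₀ b₁ b₂ →
    ((p ℤ.+ k ℤ.- j) ℤ.* (+ 1 ℤ.+ (p ℤ.+ k) ℤ.+ j) ℤ.* b₀ ℤ.+ (+ 1 ℤ.+ j) ℤ.* (+ 2 ℤ.+ j) ℤ.* b₂
      ℤ.+ (+ 1 ℤ.+ j) ℤ.* (+ 1 ℤ.+ + 2 ℤ.* p) ℤ.* b₁)
    ℤ.- ((+ 1 ℤ.+ j) ℤ.* (+ 1 ℤ.+ + 2 ℤ.* (p ℤ.+ k)) ℤ.* b₁ ℤ.+ (+ 1 ℤ.+ (p ℤ.+ k) ℤ.+ k) ℤ.* p ℤ.* b₀)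
    ≡ (j ℤ.+ + 1) ℤ.* (((+ 2 ℤ.+ j) ℤ.* b₂ ℤ.+ (+ 1 ℤ.+ j) ℤ.* b₁) ℤ.- k ℤ.* b₁)
      ℤ.- (k ℤ.+ j ℤ.+ + 1) ℤ.* (((+ 1 ℤ.+ j) ℤ.* b₁ ℤ.+ j ℤ.* b₀) ℤ.- k ℤ.* b₀)
  ring = ℤSolver.solve-∀

C-shift-ℤ : ∀ n k → + suc k ℤ.* + (n C suc k) ℤ.+ + k ℤ.* + (n C k) ≡ + n ℤ.* + (n C k)
C-shift-ℤ n k = begin
  + suc k ℤ.* + (n C suc k) ℤ.+ + k ℤ.* + (n C k)
    ≡⟨ cong₂ ℤ._+_ (ℤ.pos-* (suc k) (n C suc k)) (ℤ.pos-* k (n C k)) ⟨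
  + (suc k * (n C suc k) + k * (n C k)) ≡⟨ cong +_ (C-shift n k) ⟩
  + (n * (n C k))                       ≡⟨ ℤ.pos-* n (n C k) ⟩
  + n ℤ.* + (n C k)                     ∎
  where open ≡-Reasoning

-- The desired recurrence for truncated sums, with `t` as the boundary term left over by
-- telescoping.
Partial : ℕ → ℕ → ℕ → ℕ → ℤ → Set
Partial m j n k t =
  (+ m ℤ.- + j) ℤ.* + suc (m + j) ℤ.* + partial m j n
    ℤ.+ + suc j ℤ.* + suc (suc j) ℤ.* + partial m (suc (suc j)) n
  ≡ + suc j ℤ.* (+ 1 ℤ.+ + 2 ℤ.* + m) ℤ.* + partial m (suc j) n ℤ.+ t

-- Adding the k-th terms, that is `summand` times `coeff m k`, trades the boundary term on the left
-- of k for the one on its right.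
partial-step : ∀ j k p → let m = p + k in
  Partial m j k k (+ suc j ℤ.* (+ 1 ℤ.+ + 2 ℤ.* + p) ℤ.* (+ coeff m k ℤ.* + (k C suc j))) →
  Partial m j (suc k) k (+ suc (m + k) ℤ.* + p ℤ.* (+ coeff m k ℤ.* + (k C j)))
partial-step j k p ih = begin
  u ℤ.* + (X + c * b₀) ℤ.+ v ℤ.* + (V + c * b₂)
    ≡⟨ cong₂ (λ x y → u ℤ.* (+ X ℤ.+ x) ℤ.+ v ℤ.* (+ V ℤ.+ y)) (ℤ.pos-* c b₀) (ℤ.pos-* c b₂) ⟩
  u ℤ.* (+ X ℤ.+ + c ℤ.* + b₀) ℤ.+ v ℤ.* (+ V ℤ.+ + c ℤ.* + b₂)
    ≡⟨ regroup u v (+ X) (+ V) (+ c) (+ b₀) (+ b₂) ⟩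
  (u ℤ.* + X ℤ.+ v ℤ.* + V) ℤ.+ + c ℤ.* (u ℤ.* + b₀ ℤ.+ v ℤ.* + b₂)
    ≡⟨ cong (ℤ._+ + c ℤ.* (u ℤ.* + b₀ ℤ.+ v ℤ.* + b₂)) ih ⟩
  (w ℤ.* + Y ℤ.+ g ℤ.* (+ c ℤ.* + b₁)) ℤ.+ + c ℤ.* (u ℤ.* + b₀ ℤ.+ v ℤ.* + b₂)
    ≡⟨ collect w (+ Y) g (+ c) (+ b₁) (u ℤ.* + b₀ ℤ.+ v ℤ.* + b₂) ⟩
  w ℤ.* + Y ℤ.+ + c ℤ.* ((u ℤ.* + b₀ ℤ.+ v ℤ.* + b₂) ℤ.+ g ℤ.* + b₁)
    ≡⟨ cong (λ x → w ℤ.* + Y ℤ.+ + c ℤ.* x)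
         (summand (+ j) (+ k) (+ p) (+ b₀) (+ b₁) (+ b₂) (C-shift-ℤ k j) (C-shift-ℤ k (suc j))) ⟩
  w ℤ.* + Y ℤ.+ + c ℤ.* (w ℤ.* + b₁ ℤ.+ + suc (m + k) ℤ.* + p ℤ.* + b₀)
    ≡⟨ expand w (+ Y) (+ c) (+ b₁) (+ suc (m + k) ℤ.* + p) (+ b₀) ⟩
  w ℤ.* (+ Y ℤ.+ + c ℤ.* + b₁) ℤ.+ + suc (m + k) ℤ.* + p ℤ.* (+ c ℤ.* + b₀)
    ≡⟨ cong (λ x → w ℤ.* (+ Y ℤ.+ x) ℤ.+ + suc (m + k) ℤ.* + p ℤ.* (+ c ℤ.* + b₀)) (ℤ.pos-* c b₁) ⟨
  w ℤ.* + (Y + c * b₁) ℤ.+ + suc (m + k) ℤ.* + p ℤ.* (+ c ℤ.* + b₀) ∎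
  where
  open ≡-Reasoning
  m = p + k
  c = coeff m k
  b₀ = k C j
  b₁ = k C suc j
  b₂ = k C suc (suc j)
  X = partial m j k
  Y = partial m (suc j) k
  V = partial m (suc (suc j)) k
  u = (+ m ℤ.- + j) ℤ.* + suc (m + j)
  v = + suc j ℤ.* + suc (suc j)
  w = + suc j ℤ.* (+ 1 ℤ.+ + 2 ℤ.* + m)
  g = + suc j ℤ.* (+ 1 ℤ.+ + 2 ℤ.* + p)
  regroup : ∀ u v X V c b₀ b₂ → u ℤ.* (X ℤ.+ c ℤ.* b₀) ℤ.+ v ℤ.* (V ℤ.+ c ℤ.* b₂)
    ≡ (u ℤ.* X ℤ.+ v ℤ.* V) ℤ.+ c ℤ.* (u ℤ.* b₀ ℤ.+ v ℤ.* b₂)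
  regroup = ℤSolver.solve-∀
  collect : ∀ w Y g c b₁ r → (w ℤ.* Y ℤ.+ g ℤ.* (c ℤ.* b₁)) ℤ.+ c ℤ.* r
    ≡ w ℤ.* Y ℤ.+ c ℤ.* (r ℤ.+ g ℤ.* b₁)
  collect = ℤSolver.solve-∀
  expand : ∀ w Y c b₁ q b₀ → w ℤ.* Y ℤ.+ c ℤ.* (w ℤ.* b₁ ℤ.+ q ℤ.* b₀)
    ≡ w ℤ.* (Y ℤ.+ c ℤ.* b₁) ℤ.+ q ℤ.* (c ℤ.* b₀)
  expand = ℤSolver.solve-∀

-- Makes the sum telescope: the boundary term to the right of k is the one to the left of k + 1. The
-- term ratio handles the coefficients, and absorption handles the binomials.
telescope-term : ∀ j k p → let m = suc p + k in
  + suc (m + k) ℤ.* + suc p ℤ.* (+ coeff m k ℤ.* + (k C j))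
  ≡ + suc j ℤ.* (+ 1 ℤ.+ + 2 ℤ.* + p) ℤ.* (+ coeff m (suc k) ℤ.* + (suc k C suc j))
telescope-term j k p = begin
  + suc (m + k) ℤ.* + suc p ℤ.* (+ coeff m k ℤ.* + (k C j))
    ≡⟨ cong₂ ℤ._*_ (ℤ.pos-* (suc (m + k)) (suc p)) (ℤ.pos-* (coeff m k) (k C j)) ⟨
  + (suc (m + k) * suc p) ℤ.* + (coeff m k * (k C j))
    ≡⟨ ℤ.pos-* (suc (m + k) * suc p) (coeff m k * (k C j)) ⟨
  + (suc (m + k) * suc p * (coeff m k * (k C j)))
    ≡⟨ cong +_ nat ⟩
  + (suc j * suc (2 * p) * (coeff m (suc k) * (suc k C suc j)))
    ≡⟨ ℤ.pos-* (suc j * suc (2 * p)) (coeff m (suc k) * (suc k C suc j)) ⟩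
  + (suc j * suc (2 * p)) ℤ.* + (coeff m (suc k) * (suc k C suc j))
    ≡⟨ cong₂ ℤ._*_ (trans (ℤ.pos-* (suc j) (suc (2 * p)))
                      (cong (λ x → + suc j ℤ.* (+ 1 ℤ.+ x)) (ℤ.pos-* 2 p)))
                   (ℤ.pos-* (coeff m (suc k)) (suc k C suc j)) ⟩
  + suc j ℤ.* (+ 1 ℤ.+ + 2 ℤ.* + p) ℤ.* (+ coeff m (suc k) ℤ.* + (suc k C suc j)) ∎
  where
  open ≡-Reasoning
  m = suc p + k
  assoc : ∀ x c b → x * (c * b) ≡ x * c * b
  assoc = ℕSolver.solve-∀
  swap₁ : ∀ k p c b → k * p * c * b ≡ p * c * (k * b)
  swap₁ = ℕSolver.solve-∀
  swap₂ : ∀ j p c b → p * c * (j * b) ≡ j * p * (c * b)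
  swap₂ = ℕSolver.solve-∀
  nat : suc (m + k) * suc p * (coeff m k * (k C j)) ≡ suc j * suc (2 * p) * (coeff m (suc k) * (suc k C suc j))
  nat = begin
    suc (m + k) * suc p * (coeff m k * (k C j))
      ≡⟨ assoc (suc (m + k) * suc p) (coeff m k) (k C j) ⟩
    suc (m + k) * suc p * coeff m k * (k C j)
      ≡⟨ cong (_* (k C j)) (coeff-suc p k) ⟨
    suc k * suc (2 * p) * coeff m (suc k) * (k C j)
      ≡⟨ swap₁ (suc k) (suc (2 * p)) (coeff m (suc k)) (k C j) ⟩
    suc (2 * p) * coeff m (suc k) * (suc k * (k C j))
      ≡⟨ cong (suc (2 * p) * coeff m (suc k) *_) (C-absorption k j) ⟨
    suc (2 * p) * coeff m (suc k) * (suc j * (suc k C suc j))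
      ≡⟨ swap₂ (suc j) (suc (2 * p)) (coeff m (suc k)) (suc k C suc j) ⟩
    suc j * suc (2 * p) * (coeff m (suc k) * (suc k C suc j)) ∎

-- Induction on k with m = p + k fixed, so p grows as k falls. At k = 0 the incoming boundary term
-- vanishes because C(0, j + 1) = 0.
telescope : ∀ j k p → let m = p + k in
  Partial m j (suc k) k (+ suc (m + k) ℤ.* + p ℤ.* (+ coeff m k ℤ.* + (k C j)))
telescope j zero p = partial-step j zero p (begin
  u ℤ.* + 0 ℤ.+ v ℤ.* + 0  ≡⟨ zeros u v w g (+ coeff (p + 0) 0) ⟩
  w ℤ.* + 0 ℤ.+ g ℤ.* (+ coeff (p + 0) 0 ℤ.* + 0)
    ≡⟨ cong (λ b → w ℤ.* + 0 ℤ.+ g ℤ.* (+ coeff (p + 0) 0 ℤ.* + b)) (k>n⇒nCk≡0 {0} {suc j} (s≤s z≤n)) ⟨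
  w ℤ.* + 0 ℤ.+ g ℤ.* (+ coeff (p + 0) 0 ℤ.* + (0 C suc j)) ∎)
  where
  open ≡-Reasoning
  u = (+ (p + 0) ℤ.- + j) ℤ.* + suc (p + 0 + j)
  v = + suc j ℤ.* + suc (suc j)
  w = + suc j ℤ.* (+ 1 ℤ.+ + 2 ℤ.* + (p + 0))
  g = + suc j ℤ.* (+ 1 ℤ.+ + 2 ℤ.* + p)
  zeros : ∀ u v w g c → u ℤ.* + 0 ℤ.+ v ℤ.* + 0 ≡ w ℤ.* + 0 ℤ.+ g ℤ.* (c ℤ.* + 0)
  zeros = ℤSolver.solve-∀
telescope j (suc k) p = partial-step j (suc k) p
  (subst
    (λ m → Partial m j (suc k) (suc k)
      (+ suc j ℤ.* (+ 1 ℤ.+ + 2 ℤ.* + p) ℤ.* (+ coeff m (suc k) ℤ.* + (suc k C suc j))))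
    (sym (ℕ.+-suc p k))
    (subst (Partial (suc p + k) j (suc k) (suc k)) (telescope-term j k p) (telescope j k (suc p))))

bm-recurrence : ∀ a j → let m = a + j in
  + a ℤ.* + suc (m + j) ℤ.* + bm j m ℤ.+ + suc j ℤ.* + suc (suc j) ℤ.* + bm (suc (suc j)) m
  ≡ + suc j ℤ.* (+ 1 ℤ.+ + 2 ℤ.* + m) ℤ.* + bm (suc j) m
bm-recurrence a j
  rewrite bm-partial (a + j) j | bm-partial (a + j) (suc j) | bm-partial (a + j) (suc (suc j)) = begin
  + a ℤ.* + suc (m + j) ℤ.* + X ℤ.+ + suc j ℤ.* + suc (suc j) ℤ.* + V
    ≡⟨ cong (λ x → x ℤ.* + suc (m + j) ℤ.* + X ℤ.+ + suc j ℤ.* + suc (suc j) ℤ.* + V) (difference (+ a) (+ j)) ⟨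
  (+ m ℤ.- + j) ℤ.* + suc (m + j) ℤ.* + X ℤ.+ + suc j ℤ.* + suc (suc j) ℤ.* + V
    -- At k = m the factor p = m - k of the boundary term is 0.
    ≡⟨ telescope j m 0 ⟩
  + suc j ℤ.* (+ 1 ℤ.+ + 2 ℤ.* + m) ℤ.* + Y ℤ.+ + suc (m + m) ℤ.* + 0 ℤ.* (+ coeff m m ℤ.* + (m C j))
    ≡⟨ vanish (+ suc j ℤ.* (+ 1 ℤ.+ + 2 ℤ.* + m) ℤ.* + Y) (+ suc (m + m)) (+ coeff m m ℤ.* + (m C j)) ⟩
  + suc j ℤ.* (+ 1 ℤ.+ + 2 ℤ.* + m) ℤ.* + Y ∎
  where
  open ≡-Reasoning
  m = a + j
  X = partial m j (suc m)
  Y = partial m (suc j) (suc m)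
  V = partial m (suc (suc j)) (suc m)
  difference : ∀ a j → a ℤ.+ j ℤ.- j ≡ a
  difference = ℤSolver.solve-∀
  vanish : ∀ y s t → y ℤ.+ s ℤ.* + 0 ℤ.* t ≡ y
  vanish = ℤSolver.solve-∀

-- Bounds for consecutive ratios

C-pos : ∀ p k → 0 < (k + p) C k
C-pos p zero    = s≤s z≤n
C-pos p (suc k) = subst (0 <_) (nCk+nC[k+1]≡[n+1]C[k+1] (k + p) k)
  (ℕ.<-≤-trans (C-pos p k) (ℕ.m≤m+n _ _))

bm-diagonal-pos : ∀ m → 0 < bm m m
bm-diagonal-pos m = subst (0 <_) (sym (bm-partial m m)) (ℕ.<-≤-trans last-pos (ℕ.m≤n+m _ (partial m m m)))
  where
  coeff-pos : 0 < coeff m m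
  coeff-pos = subst (0 <_) (sym (coeff-+ 0 m))
    (ℕ.*-mono-< (ℕ.*-mono-< (ℕ.m^n>0 2 m) (s≤s (z≤n {0}))) (C-pos m m))
  last-pos : 0 < coeff m m * (m C m)
  last-pos = ℕ.*-mono-< coeff-pos (subst (0 <_) (sym (nCn≡1 m)) (s≤s z≤n))

0<*0<⇒0< : ∀ {x y} → + 0 ℤ.< x → + 0 ℤ.< y → + 0 ℤ.< x ℤ.* y
0<*0<⇒0< {+[1+ x ]} {+[1+ y ]} _ _ = ℤ.+<+ (s≤s z≤n)
0<*0<⇒0< {+[1+ x ]} {+ 0} _ (ℤ.+<+ ())
0<*0<⇒0< {+ 0} (ℤ.+<+ ()) _

0≤-cancelˡ : ∀ {c x} → + 0 ℤ.< c → + 0 ℤ.≤ c ℤ.* x → + 0 ℤ.≤ x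
0≤-cancelˡ {c} {x} 0<c 0≤cx = ℤ.*-cancelˡ-≤-pos (+ 0) x c {{ℤ.positive 0<c}}
  (subst (ℤ._≤ c ℤ.* x) (sym (ℤ.*-zeroʳ c)) 0≤cx)

0<-cancelˡ : ∀ {c x} → + 0 ℤ.< c → + 0 ℤ.< c ℤ.* x → + 0 ℤ.< x
0<-cancelˡ {c} {x} 0<c 0<cx = ℤ.*-cancelˡ-<-nonNeg c {{ℤ.nonNegative (ℤ.<⇒≤ 0<c)}}
  (subst (ℤ._< c ℤ.* x) (sym (ℤ.*-zeroʳ c)) 0<cx)

infixr 6 _⊕_
infixr 7 _⊗_

-- With `_⊗_` this builds a nonnegativity proof in the shape of the expression itself. Both
-- associate to the right, which is why the polynomials in `ring-lower` are nested that way.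
_⊕_ : ∀ {x y} → + 0 ℤ.≤ x → + 0 ℤ.≤ y → + 0 ℤ.≤ x ℤ.+ y
_⊕_ = ℤ.+-mono-≤

_⊗_ : ∀ {x y} → + 0 ℤ.≤ x → + 0 ℤ.≤ y → + 0 ℤ.≤ x ℤ.* y
_⊗_ {+ x} {+ y} _ _ = subst (+ 0 ℤ.≤_) (ℤ.pos-* x y) (ℤ.+≤+ z≤n)

0≤+_ : ∀ n → + 0 ℤ.≤ + n
0≤+ n = ℤ.+≤+ z≤n

-- Bounds for the ratio of A = dᵢ₋₁(m) and B = dᵢ(m), with a = m + 1 - i: writing
-- a A = (1 + z) i B they say 0 ≤ z, z ≤ 1 / (2 i) and z ≥ i / (2 (i² + a - 1)).
record RatioBounds (i a A B : ℤ) : Set where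
  excess : ℤ
  excess = a ℤ.* A ℤ.- i ℤ.* B
  field
    positive : + 0 ℤ.< A
    lower₀   : + 0 ℤ.≤ excess
    upper    : + 0 ℤ.≤ B ℤ.- + 2 ℤ.* excess
    lower    : + 0 ℤ.≤ + 2 ℤ.* (i ℤ.* i ℤ.+ a ℤ.- + 1) ℤ.* excess ℤ.- i ℤ.* i ℤ.* B

-- Proof modulo a hypothesis: the ring solver supplies the unconditional identity with the multiple
-- `k` of l - r, and l ≡ r then deletes that multiple.
combine : ∀ {x y l r} k → x ≡ y ℤ.+ k ℤ.* (l ℤ.- r) → l ≡ r → x ≡ y
combine {x} {y} {l} {r} k x≡ l≡r = trans x≡ (trans
  (cong (λ d → y ℤ.+ k ℤ.* d) (ℤ.i≡j⇒i-j≡0 l≡r))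
  (trans (cong (ℤ._+_ y) (ℤ.*-zeroʳ k)) (ℤ.+-identityʳ y)))

-- Let Z and Z′ be the excesses at i and i + 1. The recurrence becomes s Z = i (B + Z′), free of
-- minus signs, so nonnegativity descends. Since n B = Z′ + (1 + i) E, also s (B - 2 Z) = 3 Z′ + (1
-- + i) (E - 2 Z′).
bounds-step : ∀ {i n A B E} → let a = + 1 ℤ.+ n; s = n ℤ.+ + 2 ℤ.* i in
  + 0 ℤ.< i → + 0 ℤ.≤ n →
  a ℤ.* s ℤ.* A ℤ.+ i ℤ.* (+ 1 ℤ.+ i) ℤ.* E ≡ i ℤ.* (s ℤ.+ a) ℤ.* B →
  RatioBounds (+ 1 ℤ.+ i) n B E → RatioBounds i a A B
bounds-step {i} {n} {A} {B} {E} 0<i 0≤n rec bounds = record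
  { positive = 0<-cancelˡ {a} {A} 0<a
      (subst (+ 0 ℤ.<_) (aA (a ℤ.* A) (i ℤ.* B))
        (ℤ.+-mono-≤-< 0≤excess (0<*0<⇒0< {i} {B} 0<i positive)))
  ; lower₀   = 0≤excess
  ; upper    = 0≤-cancelˡ {t} 0<t (subst (+ 0 ℤ.≤_) (sym (combine (ℤ.- + 2) (ring-upper i n A B E) rec))
      (0≤+ 3 ⊗ lower₀ ⊕ 0≤1+i ⊗ upper))
  ; lower    = 0≤-cancelˡ {(+ 1 ℤ.+ i) ℤ.* (+ 1 ℤ.+ i) ℤ.* t} (0<*0<⇒0< (0<*0<⇒0< 0<1+i 0<1+i) 0<t)
      (subst (+ 0 ℤ.≤_)
        (sym (combine (+ 2 ℤ.* (+ 1 ℤ.+ i) ℤ.* (+ 1 ℤ.+ i) ℤ.* (i ℤ.* i ℤ.+ n)) (ring-lower i n A B E) rec))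
        -- Once B is eliminated, E carries the coefficient (2 + i) - i² up to positive factors, of
        -- no fixed sign. The old `lower` absorbs -i², the old `upper` absorbs 2 + i, and a
        -- nonnegative multiple of Z′ remains.
        (0≤i ⊗ (0≤i ⊗ 0≤i ⊗ lower
          ⊕ (0≤+ 2 ⊕ 0≤i) ⊗ 0≤1+i ⊗ 0≤1+i ⊗ upper
          ⊕ (0≤i ⊗ 0≤i ⊗ 0≤i ⊕ 0≤+ 10 ⊗ 0≤i ⊗ 0≤i ⊕ 0≤+ 13 ⊗ 0≤i ⊕ 0≤+ 6
              ⊕ 0≤+ 2 ⊗ 0≤n ⊗ (0≤+ 2 ⊗ 0≤i ⊕ 0≤+ 1)) ⊗ lower₀)))
  }
  where
  open RatioBounds bounds
  a = + 1 ℤ.+ n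
  t = n ℤ.+ + 2 ℤ.* i
  0≤i = ℤ.<⇒≤ 0<i
  0≤1+i = 0≤+ 1 ⊕ 0≤i
  0<1+i : + 0 ℤ.< + 1 ℤ.+ i
  0<1+i = ℤ.+-mono-≤-< (0≤+ 1) 0<i
  0<a : + 0 ℤ.< a
  0<a = ℤ.+-mono-<-≤ (ℤ.+<+ (s≤s z≤n)) 0≤n
  0<t : + 0 ℤ.< t
  0<t = ℤ.+-mono-≤-< 0≤n (0<*0<⇒0< {+ 2} (ℤ.+<+ (s≤s z≤n)) 0<i)
  aA : ∀ x y → x ℤ.- y ℤ.+ y ≡ x
  aA = ℤSolver.solve-∀
  ring-lower₀ : ∀ i n A B E → let a = + 1 ℤ.+ n; s = n ℤ.+ + 2 ℤ.* i in
    (n ℤ.+ + 2 ℤ.* i) ℤ.* (a ℤ.* A ℤ.- i ℤ.* B)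
    ≡ i ℤ.* (B ℤ.+ (n ℤ.* B ℤ.- (+ 1 ℤ.+ i) ℤ.* E))
      ℤ.+ + 1 ℤ.* ((a ℤ.* s ℤ.* A ℤ.+ i ℤ.* (+ 1 ℤ.+ i) ℤ.* E) ℤ.- i ℤ.* (s ℤ.+ a) ℤ.* B)
  ring-lower₀ = ℤSolver.solve-∀
  ring-upper : ∀ i n A B E → let a = + 1 ℤ.+ n; s = n ℤ.+ + 2 ℤ.* i
                                 Z = n ℤ.* B ℤ.- (+ 1 ℤ.+ i) ℤ.* E in
    (n ℤ.+ + 2 ℤ.* i) ℤ.* (B ℤ.- + 2 ℤ.* (a ℤ.* A ℤ.- i ℤ.* B))
    ≡ (+ 3 ℤ.* Z ℤ.+ (+ 1 ℤ.+ i) ℤ.* (E ℤ.- + 2 ℤ.* Z))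
      ℤ.+ (ℤ.- + 2) ℤ.* ((a ℤ.* s ℤ.* A ℤ.+ i ℤ.* (+ 1 ℤ.+ i) ℤ.* E) ℤ.- i ℤ.* (s ℤ.+ a) ℤ.* B)
  ring-upper = ℤSolver.solve-∀
  ring-lower : ∀ i n A B E → let a = + 1 ℤ.+ n; s = n ℤ.+ + 2 ℤ.* i
                                 Z = n ℤ.* B ℤ.- (+ 1 ℤ.+ i) ℤ.* E
                                 α = + 2 ℤ.* ((+ 1 ℤ.+ i) ℤ.* (+ 1 ℤ.+ i) ℤ.+ n ℤ.- + 1) ℤ.* Z
                                       ℤ.- (+ 1 ℤ.+ i) ℤ.* (+ 1 ℤ.+ i) ℤ.* E in
    ((+ 1 ℤ.+ i) ℤ.* (+ 1 ℤ.+ i) ℤ.* (n ℤ.+ + 2 ℤ.* i))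
      ℤ.* (+ 2 ℤ.* (i ℤ.* i ℤ.+ a ℤ.- + 1) ℤ.* (a ℤ.* A ℤ.- i ℤ.* B) ℤ.- i ℤ.* i ℤ.* B)
    ≡ i ℤ.* (i ℤ.* (i ℤ.* α)
        ℤ.+ ((+ 2 ℤ.+ i) ℤ.* ((+ 1 ℤ.+ i) ℤ.* ((+ 1 ℤ.+ i) ℤ.* (E ℤ.- + 2 ℤ.* Z)))
        ℤ.+ (i ℤ.* (i ℤ.* i) ℤ.+ (+ 10 ℤ.* (i ℤ.* i) ℤ.+ (+ 13 ℤ.* i
              ℤ.+ (+ 6 ℤ.+ + 2 ℤ.* (n ℤ.* (+ 2 ℤ.* i ℤ.+ + 1)))))) ℤ.* Z))
      ℤ.+ + 2 ℤ.* (+ 1 ℤ.+ i) ℤ.* (+ 1 ℤ.+ i) ℤ.* (i ℤ.* i ℤ.+ n)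
        ℤ.* ((a ℤ.* s ℤ.* A ℤ.+ i ℤ.* (+ 1 ℤ.+ i) ℤ.* E) ℤ.- i ℤ.* (s ℤ.+ a) ℤ.* B)
  ring-lower = ℤSolver.solve-∀
  0≤excess : + 0 ℤ.≤ a ℤ.* A ℤ.- i ℤ.* B
  0≤excess = 0≤-cancelˡ {t} 0<t (subst (+ 0 ℤ.≤_) (sym (combine (+ 1) (ring-lower₀ i n A B E) rec))
    (0≤i ⊗ (ℤ.<⇒≤ positive ⊕ lower₀)))

bm-beyond : ∀ m → bm (suc m) m ≡ 0
bm-beyond m = cong (λ n → sum (applyUpTo f n)) (ℕ.n∸n≡0 m)
  where
  f : ℕ → ℕ
  f k = coeff m (suc m + k) * ((suc m + k) C suc m)

-- Since ℤ._*_ unfolds by definition, comparing two products of concrete integers such as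
-- + suc n by conversion is very expensive; here and below i, a, s and m are therefore
-- variables constrained by equations.
bm-recurrence′ : ∀ n j {m i a s} → m ≡ suc n + j →
  i ≡ + suc j → a ≡ + suc n → s ≡ + n ℤ.+ + 2 ℤ.* + suc j →
  a ℤ.* s ℤ.* + bm j m ℤ.+ i ℤ.* (+ 1 ℤ.+ i) ℤ.* + bm (suc (suc j)) m
  ≡ i ℤ.* (s ℤ.+ a) ℤ.* + bm (suc j) m
bm-recurrence′ n j refl refl refl refl = subst₂
  (λ s t → + suc n ℤ.* s ℤ.* + bm j m ℤ.+ + suc j ℤ.* + suc (suc j) ℤ.* + bm (suc (suc j)) m
           ≡ + suc j ℤ.* t ℤ.* + bm (suc j) m)
  (s≡ (+ n) (+ j)) (s+a≡ (+ n) (+ j)) (bm-recurrence (suc n) j)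
  where
  m = suc n + j
  s≡ : ∀ n j → + 1 ℤ.+ (+ 1 ℤ.+ n ℤ.+ j ℤ.+ j) ≡ n ℤ.+ + 2 ℤ.* (+ 1 ℤ.+ j)
  s≡ = ℤSolver.solve-∀
  s+a≡ : ∀ n j → + 1 ℤ.+ + 2 ℤ.* (+ 1 ℤ.+ n ℤ.+ j) ≡ (n ℤ.+ + 2 ℤ.* (+ 1 ℤ.+ j)) ℤ.+ (+ 1 ℤ.+ n)
  s+a≡ = ℤSolver.solve-∀

-- The induction starts one step past the diagonal, at i = m + 1: there a = 0 and dᵢ(m) = 0, so
-- every bound on the excess reads 0 ≤ 0.
ratio-bounds : ∀ a j → let m = a + j in RatioBounds (+ suc j) (+ a) (+ bm j m) (+ bm (suc j) m)
ratio-bounds zero j rewrite bm-beyond j = record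
  { positive = ℤ.+<+ (bm-diagonal-pos j)
  ; lower₀   = ℤ.≤-reflexive (sym (zero₀ (+ suc j) (+ bm j j)))
  ; upper    = ℤ.≤-reflexive (sym (zero₁ (+ suc j) (+ bm j j)))
  ; lower    = ℤ.≤-reflexive (sym (zero₂ (+ suc j) (+ bm j j)))
  }
  where
  zero₀ : ∀ i A → + 0 ℤ.* A ℤ.- i ℤ.* + 0 ≡ + 0
  zero₀ = ℤSolver.solve-∀
  zero₁ : ∀ i A → + 0 ℤ.- + 2 ℤ.* (+ 0 ℤ.* A ℤ.- i ℤ.* + 0) ≡ + 0
  zero₁ = ℤSolver.solve-∀
  zero₂ : ∀ i A → + 2 ℤ.* (i ℤ.* i ℤ.+ + 0 ℤ.- + 1) ℤ.* (+ 0 ℤ.* A ℤ.- i ℤ.* + 0) ℤ.- i ℤ.* i ℤ.* + 0 ≡ + 0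
  zero₂ = ℤSolver.solve-∀
ratio-bounds (suc n) j = bounds-step (ℤ.+<+ (s≤s z≤n)) (ℤ.+≤+ z≤n) (bm-recurrence′ n j refl refl refl refl)
  (subst (λ m → RatioBounds (+ suc (suc j)) (+ n) (+ bm (suc j) m) (+ bm (suc (suc j)) m))
    (ℕ.+-suc n j) (ratio-bounds n (suc j)))

-- The inequality over the integers

-- Natural coefficients make nonnegativity at nonnegative arguments a single induction, whatever the
-- entries of the table.
horner : List ℕ → ℤ → ℤ
horner []       n = + 0
horner (c ∷ cs) n = + c ℤ.+ n ℤ.* horner cs n

horner₂ : List (List ℕ) → ℤ → ℤ → ℤ
horner₂ []       j n = + 0
horner₂ (r ∷ rs) j n = horner r n ℤ.+ j ℤ.* horner₂ rs j n

horner-nonNeg : ∀ cs {n} → + 0 ℤ.≤ n → + 0 ℤ.≤ horner cs n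
horner-nonNeg []       0≤n = 0≤+ 0
horner-nonNeg (c ∷ cs) 0≤n = (0≤+ c) ⊕ 0≤n ⊗ horner-nonNeg cs 0≤n

horner₂-nonNeg : ∀ rs {j n} → + 0 ℤ.≤ j → + 0 ℤ.≤ n → + 0 ℤ.≤ horner₂ rs j n
horner₂-nonNeg []       0≤j 0≤n = 0≤+ 0
horner₂-nonNeg (r ∷ rs) 0≤j 0≤n = horner-nonNeg r 0≤n ⊕ 0≤j ⊗ horner₂-nonNeg rs 0≤j 0≤n

-- Coefficients of the polynomials in j = i - 1 and n = m - 1 - i that multiply Bα, Bβ
-- and Z² in positive-combination; row k collects the powers of n in front of jᵏ.
grid₁ : List (List ℕ)
grid₁ =
    (479 ∷ 592 ∷ 246 ∷ 39 ∷ 2 ∷ []) ∷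
    (1642 ∷ 1605 ∷ 508 ∷ 59 ∷ 2 ∷ []) ∷
    (2010 ∷ 1503 ∷ 324 ∷ 20 ∷ []) ∷
    (1092 ∷ 562 ∷ 62 ∷ []) ∷
    (268 ∷ 72 ∷ []) ∷
    (24 ∷ []) ∷ []

grid₂ : List (List ℕ)
grid₂ =
    (1042 ∷ 1937 ∷ 1394 ∷ 471 ∷ 72 ∷ 4 ∷ []) ∷
    (4052 ∷ 5961 ∷ 3376 ∷ 885 ∷ 102 ∷ 4 ∷ []) ∷
    (6885 ∷ 7623 ∷ 3130 ∷ 541 ∷ 32 ∷ []) ∷
    (6782 ∷ 5437 ∷ 1498 ∷ 143 ∷ 2 ∷ []) ∷
    (4154 ∷ 2343 ∷ 396 ∷ 16 ∷ []) ∷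
    (1524 ∷ 562 ∷ 46 ∷ []) ∷
    (300 ∷ 56 ∷ []) ∷
    (24 ∷ []) ∷ []

grid₃ : List (List ℕ)
grid₃ =
    (498 ∷ 571 ∷ 225 ∷ 36 ∷ 2 ∷ []) ∷
    (1308 ∷ 1057 ∷ 261 ∷ 20 ∷ []) ∷
    (1314 ∷ 702 ∷ 96 ∷ 2 ∷ []) ∷
    (648 ∷ 208 ∷ 12 ∷ []) ∷
    (160 ∷ 24 ∷ []) ∷
    (16 ∷ []) ∷ []

-- F and G are the numerators of dᵢ² - dᵢ₋₁dᵢ₊₁ and dᵢ₋₁² - dᵢ₋₂dᵢ after eliminating
-- dᵢ₋₂ and dᵢ₊₁ by the recurrence.
positive-combination : ∀ j n B Z →
  let i = + 1 ℤ.+ j; a = + 2 ℤ.+ n; b = + 1 ℤ.+ n; s = b ℤ.+ + 2 ℤ.* i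
      F = i ℤ.* (a ℤ.* (B ℤ.* B)) ℤ.+ i ℤ.* (s ℤ.- a) ℤ.* (B ℤ.* Z) ℤ.+ s ℤ.* (Z ℤ.* Z)
      G = (+ 1 ℤ.+ a) ℤ.* (s ℤ.- + 1) ℤ.* ((Z ℤ.+ i ℤ.* B) ℤ.* (Z ℤ.+ i ℤ.* B))
            ℤ.- (i ℤ.- + 1) ℤ.* a ℤ.* (B ℤ.* ((s ℤ.+ a) ℤ.* (Z ℤ.+ i ℤ.* B) ℤ.- i ℤ.* a ℤ.* B))
      β = B ℤ.- + 2 ℤ.* Z
      α = + 2 ℤ.* b ℤ.* Z ℤ.- i ℤ.* i ℤ.* β
  in
  + 2 ℤ.* b ℤ.* ((+ 2 ℤ.+ i) ℤ.* ((s ℤ.+ + 3) ℤ.* (s ℤ.+ + 3)) ℤ.* (s ℤ.- + 1) ℤ.* F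
              ℤ.- i ℤ.* ((s ℤ.+ + 2) ℤ.* (s ℤ.+ + 2)) ℤ.* G)
  ≡ B ℤ.* (b ℤ.* B ℤ.+ horner₂ grid₁ j n ℤ.* α ℤ.+ horner₂ grid₂ j n ℤ.* β)
    ℤ.+ + 2 ℤ.* b ℤ.* horner₂ grid₃ j n ℤ.* (Z ℤ.* Z)
positive-combination = expanded
  where
  -- The ring solver does not unfold horner₂.
  expanded : ∀ j n B Z →
    let i = + 1 ℤ.+ j; a = + 2 ℤ.+ n; b = + 1 ℤ.+ n; s = b ℤ.+ + 2 ℤ.* i
        F = i ℤ.* (a ℤ.* (B ℤ.* B)) ℤ.+ i ℤ.* (s ℤ.- a) ℤ.* (B ℤ.* Z) ℤ.+ s ℤ.* (Z ℤ.* Z)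
        G = (+ 1 ℤ.+ a) ℤ.* (s ℤ.- + 1) ℤ.* ((Z ℤ.+ i ℤ.* B) ℤ.* (Z ℤ.+ i ℤ.* B))
              ℤ.- (i ℤ.- + 1) ℤ.* a ℤ.* (B ℤ.* ((s ℤ.+ a) ℤ.* (Z ℤ.+ i ℤ.* B) ℤ.- i ℤ.* a ℤ.* B))
        β = B ℤ.- + 2 ℤ.* Z
        α = + 2 ℤ.* b ℤ.* Z ℤ.- i ℤ.* i ℤ.* β
        p₁ = ((+ 479 ℤ.+ n ℤ.* (+ 592 ℤ.+ n ℤ.* (+ 246 ℤ.+ n ℤ.* (+ 39 ℤ.+ n ℤ.* (+ 2 ℤ.+ n ℤ.* + 0))))) ℤ.+ j ℤ.*
             ((+ 1642 ℤ.+ n ℤ.* (+ 1605 ℤ.+ n ℤ.* (+ 508 ℤ.+ n ℤ.* (+ 59 ℤ.+ n ℤ.* (+ 2 ℤ.+ n ℤ.* + 0))))) ℤ.+ j ℤ.*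
             ((+ 2010 ℤ.+ n ℤ.* (+ 1503 ℤ.+ n ℤ.* (+ 324 ℤ.+ n ℤ.* (+ 20 ℤ.+ n ℤ.* + 0)))) ℤ.+ j ℤ.*
             ((+ 1092 ℤ.+ n ℤ.* (+ 562 ℤ.+ n ℤ.* (+ 62 ℤ.+ n ℤ.* + 0))) ℤ.+ j ℤ.*
             ((+ 268 ℤ.+ n ℤ.* (+ 72 ℤ.+ n ℤ.* + 0)) ℤ.+ j ℤ.*
             ((+ 24 ℤ.+ n ℤ.* + 0) ℤ.+ j ℤ.* + 0))))))
        p₂ = ((+ 1042 ℤ.+ n ℤ.* (+ 1937 ℤ.+ n ℤ.* (+ 1394 ℤ.+ n ℤ.* (+ 471 ℤ.+ n ℤ.* (+ 72 ℤ.+ n ℤ.* (+ 4 ℤ.+ n ℤ.* + 0)))))) ℤ.+ j ℤ.*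
             ((+ 4052 ℤ.+ n ℤ.* (+ 5961 ℤ.+ n ℤ.* (+ 3376 ℤ.+ n ℤ.* (+ 885 ℤ.+ n ℤ.* (+ 102 ℤ.+ n ℤ.* (+ 4 ℤ.+ n ℤ.* + 0)))))) ℤ.+ j ℤ.*
             ((+ 6885 ℤ.+ n ℤ.* (+ 7623 ℤ.+ n ℤ.* (+ 3130 ℤ.+ n ℤ.* (+ 541 ℤ.+ n ℤ.* (+ 32 ℤ.+ n ℤ.* + 0))))) ℤ.+ j ℤ.*
             ((+ 6782 ℤ.+ n ℤ.* (+ 5437 ℤ.+ n ℤ.* (+ 1498 ℤ.+ n ℤ.* (+ 143 ℤ.+ n ℤ.* (+ 2 ℤ.+ n ℤ.* + 0))))) ℤ.+ j ℤ.*
             ((+ 4154 ℤ.+ n ℤ.* (+ 2343 ℤ.+ n ℤ.* (+ 396 ℤ.+ n ℤ.* (+ 16 ℤ.+ n ℤ.* + 0)))) ℤ.+ j ℤ.*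
             ((+ 1524 ℤ.+ n ℤ.* (+ 562 ℤ.+ n ℤ.* (+ 46 ℤ.+ n ℤ.* + 0))) ℤ.+ j ℤ.*
             ((+ 300 ℤ.+ n ℤ.* (+ 56 ℤ.+ n ℤ.* + 0)) ℤ.+ j ℤ.*
             ((+ 24 ℤ.+ n ℤ.* + 0) ℤ.+ j ℤ.* + 0))))))))
        p₃ = ((+ 498 ℤ.+ n ℤ.* (+ 571 ℤ.+ n ℤ.* (+ 225 ℤ.+ n ℤ.* (+ 36 ℤ.+ n ℤ.* (+ 2 ℤ.+ n ℤ.* + 0))))) ℤ.+ j ℤ.*
             ((+ 1308 ℤ.+ n ℤ.* (+ 1057 ℤ.+ n ℤ.* (+ 261 ℤ.+ n ℤ.* (+ 20 ℤ.+ n ℤ.* + 0)))) ℤ.+ j ℤ.*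
             ((+ 1314 ℤ.+ n ℤ.* (+ 702 ℤ.+ n ℤ.* (+ 96 ℤ.+ n ℤ.* (+ 2 ℤ.+ n ℤ.* + 0)))) ℤ.+ j ℤ.*
             ((+ 648 ℤ.+ n ℤ.* (+ 208 ℤ.+ n ℤ.* (+ 12 ℤ.+ n ℤ.* + 0))) ℤ.+ j ℤ.*
             ((+ 160 ℤ.+ n ℤ.* (+ 24 ℤ.+ n ℤ.* + 0)) ℤ.+ j ℤ.*
             ((+ 16 ℤ.+ n ℤ.* + 0) ℤ.+ j ℤ.* + 0))))))
    in
    + 2 ℤ.* b ℤ.* ((+ 2 ℤ.+ i) ℤ.* ((s ℤ.+ + 3) ℤ.* (s ℤ.+ + 3)) ℤ.* (s ℤ.- + 1) ℤ.* F
                ℤ.- i ℤ.* ((s ℤ.+ + 2) ℤ.* (s ℤ.+ + 2)) ℤ.* G)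
    ≡ B ℤ.* (b ℤ.* B ℤ.+ p₁ ℤ.* α ℤ.+ p₂ ℤ.* β) ℤ.+ + 2 ℤ.* b ℤ.* p₃ ℤ.* (Z ℤ.* Z)
  expanded = ℤSolver.solve-∀

-- Here i = j + 1 and m = i + n + 1, so that a = m + 1 - i and s = m + i, and W, A, B, E
-- stand for dᵢ₋₂(m), dᵢ₋₁(m), dᵢ(m), dᵢ₊₁(m).
turan-bounds : ∀ {j n W A B E} →
  let i = + 1 ℤ.+ j; a = + 2 ℤ.+ n; s = + 1 ℤ.+ n ℤ.+ + 2 ℤ.* i
      N = A ℤ.* A ℤ.- W ℤ.* B
      D = B ℤ.* B ℤ.- A ℤ.* E
      P = (+ 1 ℤ.+ i) ℤ.* (+ 2 ℤ.+ i) ℤ.* ((s ℤ.+ + 3) ℤ.* (s ℤ.+ + 3))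
      Q = a ℤ.* (+ 1 ℤ.+ a) ℤ.* ((s ℤ.+ + 2) ℤ.* (s ℤ.+ + 2))
  in
  + 0 ℤ.≤ j → + 0 ℤ.≤ n →
  (+ 1 ℤ.+ a) ℤ.* (s ℤ.- + 1) ℤ.* W ℤ.+ (i ℤ.- + 1) ℤ.* i ℤ.* B ≡ (i ℤ.- + 1) ℤ.* (s ℤ.+ a) ℤ.* A →
  a ℤ.* s ℤ.* A ℤ.+ i ℤ.* (+ 1 ℤ.+ i) ℤ.* E ≡ i ℤ.* (s ℤ.+ a) ℤ.* B →
  RatioBounds i a A B → + 0 ℤ.< B →
  + 0 ℤ.< D × + 0 ℤ.< P ℤ.* D ℤ.- Q ℤ.* N
turan-bounds {j} {n} {W} {A} {B} {E} 0≤j 0≤n rec₁ rec₂ bounds 0<B =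
    0<-cancelˡ (0<*0<⇒0< (0<*0<⇒0< 0<a 0<i) 0<1+i) (subst (+ 0 ℤ.<_) (sym aiD≡F) 0<F)
  , 0<-cancelˡ {+ 2 ℤ.* b ℤ.* (i ℤ.* a ℤ.* (s ℤ.- + 1))}
      (0<*0<⇒0< 0<2b (0<*0<⇒0< (0<*0<⇒0< 0<i 0<a) 0<s-1))
      (subst (+ 0 ℤ.<_) (sym scaled) 0<combination)
  where
  open RatioBounds bounds renaming (excess to Z)
  i = + 1 ℤ.+ j
  a = + 2 ℤ.+ n
  b = + 1 ℤ.+ n
  s = b ℤ.+ + 2 ℤ.* i
  N = A ℤ.* A ℤ.- W ℤ.* B
  D = B ℤ.* B ℤ.- A ℤ.* E
  P = (+ 1 ℤ.+ i) ℤ.* (+ 2 ℤ.+ i) ℤ.* ((s ℤ.+ + 3) ℤ.* (s ℤ.+ + 3))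
  Q = a ℤ.* (+ 1 ℤ.+ a) ℤ.* ((s ℤ.+ + 2) ℤ.* (s ℤ.+ + 2))
  F = i ℤ.* (a ℤ.* (B ℤ.* B)) ℤ.+ i ℤ.* (s ℤ.- a) ℤ.* (B ℤ.* Z) ℤ.+ s ℤ.* (Z ℤ.* Z)
  G = (+ 1 ℤ.+ a) ℤ.* (s ℤ.- + 1) ℤ.* ((Z ℤ.+ i ℤ.* B) ℤ.* (Z ℤ.+ i ℤ.* B))
        ℤ.- (i ℤ.- + 1) ℤ.* a ℤ.* (B ℤ.* ((s ℤ.+ a) ℤ.* (Z ℤ.+ i ℤ.* B) ℤ.- i ℤ.* a ℤ.* B))
  β = B ℤ.- + 2 ℤ.* Z
  α = + 2 ℤ.* b ℤ.* Z ℤ.- i ℤ.* i ℤ.* β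

  0<+ : ∀ c {x} → + 0 ℤ.≤ x → + 0 ℤ.< + suc c ℤ.+ x
  0<+ c 0≤x = ℤ.+-mono-<-≤ (ℤ.+<+ (s≤s z≤n)) 0≤x
  0<i = 0<+ 0 0≤j
  0<a = 0<+ 1 0≤n
  0<b = 0<+ 0 0≤n
  0<1+i = 0<+ 0 (ℤ.<⇒≤ 0<i)
  0<2b = 0<*0<⇒0< {+ 2} (ℤ.+<+ (s≤s z≤n)) 0<b
  0<s : + 0 ℤ.< s
  0<s = ℤ.+-mono-<-≤ 0<b (0≤+ 2 ⊗ ℤ.<⇒≤ 0<i)
  s-1≡ : ∀ j n → + 2 ℤ.+ (n ℤ.+ + 2 ℤ.* j) ≡ + 1 ℤ.+ n ℤ.+ + 2 ℤ.* (+ 1 ℤ.+ j) ℤ.- + 1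
  s-1≡ = ℤSolver.solve-∀
  s-a≡ : ∀ j n → + 1 ℤ.+ + 2 ℤ.* j ≡ + 1 ℤ.+ n ℤ.+ + 2 ℤ.* (+ 1 ℤ.+ j) ℤ.- (+ 2 ℤ.+ n)
  s-a≡ = ℤSolver.solve-∀
  0<s-1 : + 0 ℤ.< s ℤ.- + 1
  0<s-1 = subst (+ 0 ℤ.<_) (s-1≡ j n) (0<+ 1 (0≤n ⊕ 0≤+ 2 ⊗ 0≤j))
  0≤s-a : + 0 ℤ.≤ s ℤ.- a
  0≤s-a = subst (+ 0 ℤ.≤_) (s-a≡ j n) (0≤+ 1 ⊕ 0≤+ 2 ⊗ 0≤j)

  ring-D : ∀ i a s A B E →
    let Z = a ℤ.* A ℤ.- i ℤ.* B in
    a ℤ.* i ℤ.* (+ 1 ℤ.+ i) ℤ.* (B ℤ.* B ℤ.- A ℤ.* E)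
    ≡ (i ℤ.* (a ℤ.* (B ℤ.* B)) ℤ.+ i ℤ.* (s ℤ.- a) ℤ.* (B ℤ.* Z) ℤ.+ s ℤ.* (Z ℤ.* Z))
      ℤ.+ (ℤ.- (a ℤ.* A)) ℤ.* ((a ℤ.* s ℤ.* A ℤ.+ i ℤ.* (+ 1 ℤ.+ i) ℤ.* E) ℤ.- i ℤ.* (s ℤ.+ a) ℤ.* B)
  ring-D = ℤSolver.solve-∀
  aiD≡F : a ℤ.* i ℤ.* (+ 1 ℤ.+ i) ℤ.* D ≡ F
  aiD≡F = combine (ℤ.- (a ℤ.* A)) (ring-D i a s A B E) rec₂

  ring-N : ∀ i a s W A B →
    let Z = a ℤ.* A ℤ.- i ℤ.* B in
    a ℤ.* a ℤ.* (+ 1 ℤ.+ a) ℤ.* (s ℤ.- + 1) ℤ.* (A ℤ.* A ℤ.- W ℤ.* B)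
    ≡ ((+ 1 ℤ.+ a) ℤ.* (s ℤ.- + 1) ℤ.* ((Z ℤ.+ i ℤ.* B) ℤ.* (Z ℤ.+ i ℤ.* B))
        ℤ.- (i ℤ.- + 1) ℤ.* a ℤ.* (B ℤ.* ((s ℤ.+ a) ℤ.* (Z ℤ.+ i ℤ.* B) ℤ.- i ℤ.* a ℤ.* B)))
      ℤ.+ (ℤ.- (a ℤ.* a ℤ.* B)) ℤ.* (((+ 1 ℤ.+ a) ℤ.* (s ℤ.- + 1) ℤ.* W ℤ.+ (i ℤ.- + 1) ℤ.* i ℤ.* B)
        ℤ.- (i ℤ.- + 1) ℤ.* (s ℤ.+ a) ℤ.* A)
  ring-N = ℤSolver.solve-∀
  aaN≡G : a ℤ.* a ℤ.* (+ 1 ℤ.+ a) ℤ.* (s ℤ.- + 1) ℤ.* N ≡ G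
  aaN≡G = combine (ℤ.- (a ℤ.* a ℤ.* B)) (ring-N i a s W A B) rec₁

  -- P already contains 1 + i and Q contains a (1 + a); the multiplier i a (s - 1) supplies what D
  -- and N still lack to become F and G.
  ring-scaled : ∀ i a b s D N →
    + 2 ℤ.* b ℤ.* (i ℤ.* a ℤ.* (s ℤ.- + 1)) ℤ.*
      ((+ 1 ℤ.+ i) ℤ.* (+ 2 ℤ.+ i) ℤ.* ((s ℤ.+ + 3) ℤ.* (s ℤ.+ + 3)) ℤ.* D
        ℤ.- a ℤ.* (+ 1 ℤ.+ a) ℤ.* ((s ℤ.+ + 2) ℤ.* (s ℤ.+ + 2)) ℤ.* N)
    ≡ + 2 ℤ.* b ℤ.*
      ((+ 2 ℤ.+ i) ℤ.* ((s ℤ.+ + 3) ℤ.* (s ℤ.+ + 3)) ℤ.* (s ℤ.- + 1) ℤ.* (a ℤ.* i ℤ.* (+ 1 ℤ.+ i) ℤ.* D)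
        ℤ.- i ℤ.* ((s ℤ.+ + 2) ℤ.* (s ℤ.+ + 2)) ℤ.* (a ℤ.* a ℤ.* (+ 1 ℤ.+ a) ℤ.* (s ℤ.- + 1) ℤ.* N))
  ring-scaled = ℤSolver.solve-∀
  scaled : + 2 ℤ.* b ℤ.* (i ℤ.* a ℤ.* (s ℤ.- + 1)) ℤ.* (P ℤ.* D ℤ.- Q ℤ.* N)
    ≡ B ℤ.* (b ℤ.* B ℤ.+ horner₂ grid₁ j n ℤ.* α ℤ.+ horner₂ grid₂ j n ℤ.* β)
      ℤ.+ + 2 ℤ.* b ℤ.* horner₂ grid₃ j n ℤ.* (Z ℤ.* Z)
  scaled = trans (ring-scaled i a b s D N)
    (trans (cong₂ (λ x y → + 2 ℤ.* b ℤ.*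
        ((+ 2 ℤ.+ i) ℤ.* ((s ℤ.+ + 3) ℤ.* (s ℤ.+ + 3)) ℤ.* (s ℤ.- + 1) ℤ.* x
          ℤ.- i ℤ.* ((s ℤ.+ + 2) ℤ.* (s ℤ.+ + 2)) ℤ.* y)) aiD≡F aaN≡G)
      (positive-combination j n B Z))

  0≤B = ℤ.<⇒≤ 0<B
  -- Strict log-concavity at i: the summand i a B² is positive and the others are nonnegative.
  0<F : + 0 ℤ.< F
  0<F = ℤ.+-mono-<-≤
    (ℤ.+-mono-<-≤ (0<*0<⇒0< 0<i (0<*0<⇒0< 0<a (0<*0<⇒0< 0<B 0<B)))
      ((ℤ.<⇒≤ 0<i ⊗ 0≤s-a) ⊗ (0≤B ⊗ lower₀)))
    (ℤ.<⇒≤ 0<s ⊗ (lower₀ ⊗ lower₀))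
  ring-α : ∀ i n B Z →
    + 2 ℤ.* (i ℤ.* i ℤ.+ (+ 2 ℤ.+ n) ℤ.- + 1) ℤ.* Z ℤ.- i ℤ.* i ℤ.* B
    ≡ + 2 ℤ.* (+ 1 ℤ.+ n) ℤ.* Z ℤ.- i ℤ.* i ℤ.* (B ℤ.- + 2 ℤ.* Z)
  ring-α = ℤSolver.solve-∀
  0≤α : + 0 ℤ.≤ α
  0≤α = subst (+ 0 ℤ.≤_) (ring-α i n B Z) lower
  0<combination : + 0 ℤ.< B ℤ.* (b ℤ.* B ℤ.+ horner₂ grid₁ j n ℤ.* α ℤ.+ horner₂ grid₂ j n ℤ.* β)
                          ℤ.+ + 2 ℤ.* b ℤ.* horner₂ grid₃ j n ℤ.* (Z ℤ.* Z)
  0<combination = ℤ.+-mono-<-≤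
    (0<*0<⇒0< 0<B (ℤ.+-mono-<-≤ (ℤ.+-mono-<-≤ (0<*0<⇒0< 0<b 0<B)
      (horner₂-nonNeg grid₁ 0≤j 0≤n ⊗ 0≤α)) (horner₂-nonNeg grid₂ 0≤j 0≤n ⊗ upper)))
    ((ℤ.<⇒≤ 0<2b ⊗ horner₂-nonNeg grid₃ 0≤j 0≤n) ⊗ (lower₀ ⊗ lower₀))

-- Passage to the rationals

fromℚᵘ-homo-* : ∀ p q → ℚ.fromℚᵘ (p ℚᵘ.* q) ≡ ℚ.fromℚᵘ p ℚ.* ℚ.fromℚᵘ q
fromℚᵘ-homo-* p q = ℚ.toℚᵘ-injective (begin-equality
  ℚ.toℚᵘ (ℚ.fromℚᵘ (p ℚᵘ.* q))  ≃⟨ ℚ.toℚᵘ-fromℚᵘ (p ℚᵘ.* q) ⟩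
  p ℚᵘ.* q                      ≃⟨ ℚᵘ.*-cong (ℚ.toℚᵘ-fromℚᵘ p) (ℚ.toℚᵘ-fromℚᵘ q) ⟨
  ℚ.toℚᵘ (ℚ.fromℚᵘ p) ℚᵘ.* ℚ.toℚᵘ (ℚ.fromℚᵘ q)  ≃⟨ ℚ.toℚᵘ-homo-* (ℚ.fromℚᵘ p) (ℚ.fromℚᵘ q) ⟨
  ℚ.toℚᵘ (ℚ.fromℚᵘ p ℚ.* ℚ.fromℚᵘ q)            ∎)
  where open ℚᵘ.≤-Reasoning

fromℚᵘ-homo-+ : ∀ p q → ℚ.fromℚᵘ (p ℚᵘ.+ q) ≡ ℚ.fromℚᵘ p ℚ.+ ℚ.fromℚᵘ q
fromℚᵘ-homo-+ p q = ℚ.toℚᵘ-injective (begin-equality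
  ℚ.toℚᵘ (ℚ.fromℚᵘ (p ℚᵘ.+ q))  ≃⟨ ℚ.toℚᵘ-fromℚᵘ (p ℚᵘ.+ q) ⟩
  p ℚᵘ.+ q                      ≃⟨ ℚᵘ.+-cong (ℚ.toℚᵘ-fromℚᵘ p) (ℚ.toℚᵘ-fromℚᵘ q) ⟨
  ℚ.toℚᵘ (ℚ.fromℚᵘ p) ℚᵘ.+ ℚ.toℚᵘ (ℚ.fromℚᵘ q)  ≃⟨ ℚ.toℚᵘ-homo-+ (ℚ.fromℚᵘ p) (ℚ.fromℚᵘ q) ⟨
  ℚ.toℚᵘ (ℚ.fromℚᵘ p ℚ.+ ℚ.fromℚᵘ q)            ∎)
  where open ℚᵘ.≤-Reasoning

fromℤ-homo-* : ∀ x y → fromℤ (x ℤ.* y) ≡ fromℤ x ℚ.* fromℤ y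
fromℤ-homo-* x y = fromℚᵘ-homo-* (mkℚᵘ x 0) (mkℚᵘ y 0)

fromℤ-homo-+ : ∀ x y → fromℤ (x ℤ.+ y) ≡ fromℤ x ℚ.+ fromℤ y
fromℤ-homo-+ x y = trans
  (cong₂ (λ x y → fromℤ (x ℤ.+ y)) (sym (ℤ.*-identityʳ x)) (sym (ℤ.*-identityʳ y)))
  (fromℚᵘ-homo-+ (mkℚᵘ x 0) (mkℚᵘ y 0))

fromℤ-homo-neg : ∀ x → fromℤ (ℤ.- x) ≡ ℚ.- fromℤ x
fromℤ-homo-neg (+ 0)       = refl
fromℤ-homo-neg (+[1+ n ]) = refl
fromℤ-homo-neg -[1+ n ]  = sym (Group.⁻¹-involutive ℚ.+-0-group (fromℤ +[1+ n ]))

fromℤ-homo-- : ∀ x y → fromℤ (x ℤ.- y) ≡ fromℤ x ℚ.- fromℤ y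
fromℤ-homo-- x y = trans (fromℤ-homo-+ x (ℤ.- y)) (cong (ℚ._+_ (fromℤ x)) (fromℤ-homo-neg y))

fromℤ-pos : ∀ {x} → + 0 ℤ.< x → 0ℚ ℚ.< fromℤ x
fromℤ-pos {+[1+ n ]} _ = ℚ.positive⁻¹ (fromℤ +[1+ n ]) {{ℚ.normalize-pos (suc n) 1}}
fromℤ-pos {+ 0} (ℤ.+<+ ())

/-*-cancel : ∀ z n .{{_ : NonZero n}} → (z ℚ./ n) ℚ.* fromℤ (+ n) ≡ fromℤ z
/-*-cancel z (suc n) = trans (sym (fromℚᵘ-homo-* (mkℚᵘ z n) (mkℚᵘ (+ suc n) 0)))
  (ℚ.fromℚᵘ-cong {mkℚᵘ z n ℚᵘ.* mkℚᵘ (+ suc n) 0} {mkℚᵘ z 0}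
     (*≡* (trans (ℤ.*-identityʳ _) (cong (λ n → z ℤ.* + suc n) (sym (ℕ.*-identityʳ n))))))

<⇒÷<÷ : ∀ {p q r s} (0<q : 0ℚ ℚ.< q) (0<s : 0ℚ ℚ.< s) → p ℚ.* s ℚ.< r ℚ.* q →
  (p ℚ.÷ q) {{ℚ.>-nonZero 0<q}} ℚ.< (r ℚ.÷ s) {{ℚ.>-nonZero 0<s}}
<⇒÷<÷ {p} {q} {r} {s} 0<q 0<s ps<rq =
  ℚ.*-cancelʳ-<-nonNeg (q ℚ.* s) {{ℚ.pos⇒nonNeg (q ℚ.* s) {{ℚ.pos*pos⇒pos q {{ℚ.positive 0<q}} s {{ℚ.positive 0<s}}}}}}
    (subst₂ ℚ._<_ (sym (cleared p q s)) (sym (trans (cong ((r ℚ.÷ s) ℚ.*_) (ℚ.*-comm q s)) (cleared r s q))) ps<rq)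
  where
  instance
    _ = ℚ.>-nonZero 0<q
    _ = ℚ.>-nonZero 0<s
  cleared : ∀ p q s .{{_ : ℚ.NonZero q}} → (p ℚ.÷ q) ℚ.* (q ℚ.* s) ≡ p ℚ.* s
  cleared p q s = begin
    p ℚ.* ℚ.1/ q ℚ.* (q ℚ.* s)    ≡⟨ ℚ.*-assoc p (ℚ.1/ q) (q ℚ.* s) ⟩
    p ℚ.* (ℚ.1/ q ℚ.* (q ℚ.* s))  ≡⟨ cong (p ℚ.*_) (ℚ.*-assoc (ℚ.1/ q) q s) ⟨
    p ℚ.* (ℚ.1/ q ℚ.* q ℚ.* s)    ≡⟨ cong (λ x → p ℚ.* (x ℚ.* s)) (ℚ.*-inverseˡ q) ⟩
    p ℚ.* (1ℚ ℚ.* s)              ≡⟨ cong (p ℚ.*_) (ℚ.*-identityˡ s) ⟩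
    p ℚ.* s                       ∎
    where open ≡-Reasoning

turan-scale : ∀ x y z t → (y ² ℚ.- x ℚ.* z) ℚ.* t ² ≡ (y ℚ.* t) ² ℚ.- (x ℚ.* t) ℚ.* (z ℚ.* t)
turan-scale = solve 4 (λ x y z t → (y :* y :- x :* z) :* (t :* t) := (y :* t) :* (y :* t) :- (x :* t) :* (z :* t)) refl
  where open ℚSolver.+-*-Solver

turan-fromℤ : ∀ {x y z t} {X Y Z} → x ℚ.* t ≡ fromℤ X → y ℚ.* t ≡ fromℤ Y → z ℚ.* t ≡ fromℤ Z →
  (y ² ℚ.- x ℚ.* z) ℚ.* t ² ≡ fromℤ (Y ℤ.* Y ℤ.- X ℤ.* Z)
turan-fromℤ {x} {y} {z} {t} {X} {Y} {Z} x≡ y≡ z≡ = begin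
  (y ² ℚ.- x ℚ.* z) ℚ.* t ²                    ≡⟨ turan-scale x y z t ⟩
  (y ℚ.* t) ² ℚ.- (x ℚ.* t) ℚ.* (z ℚ.* t)      ≡⟨ cong₂ ℚ._-_ (cong _² y≡) (cong₂ ℚ._*_ x≡ z≡) ⟩
  fromℤ Y ² ℚ.- fromℤ X ℚ.* fromℤ Z            ≡⟨ cong₂ ℚ._-_ (fromℤ-homo-* Y Y) (fromℤ-homo-* X Z) ⟨
  fromℤ (Y ℤ.* Y) ℚ.- fromℤ (X ℤ.* Z)          ≡⟨ fromℤ-homo-- (Y ℤ.* Y) (X ℤ.* Z) ⟨
  fromℤ (Y ℤ.* Y ℤ.- X ℤ.* Z)                  ∎
  where open ≡-Reasoning

ratio-fromℤ : ∀ {N D τ ν δ P Q} → 0ℚ ℚ.< τ → N ℚ.* τ ≡ fromℤ ν → D ℚ.* τ ≡ fromℤ δ →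
  + 0 ℤ.< δ → + 0 ℤ.< Q → + 0 ℤ.< P ℤ.* δ ℤ.- Q ℤ.* ν →
  Σ[ D≢0 ∈ ℚ.NonZero D ] Σ[ Q≢0 ∈ ℚ.NonZero (fromℤ Q) ]
    (N ℚ.÷ D) {{D≢0}} ℚ.< (fromℤ P ℚ.÷ fromℤ Q) {{Q≢0}}
ratio-fromℤ {N} {D} {τ} {ν} {δ} {P} {Q} 0<τ N≡ D≡ 0<δ 0<Q 0<Pδ-Qν =
  ℚ.>-nonZero 0<D , ℚ.>-nonZero 0<fromℤQ , <⇒÷<÷ {N} {D} {fromℤ P} {fromℤ Q} 0<D 0<fromℤQ NQ<PD
  where
  instance
    τ-nonNeg : ℚ.NonNegative τ
    τ-nonNeg = ℚ.nonNegative (ℚ.<⇒≤ 0<τ)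
  0<fromℤQ = fromℤ-pos 0<Q
  0<D : 0ℚ ℚ.< D
  0<D = ℚ.*-cancelʳ-<-nonNeg τ (subst₂ ℚ._<_ (sym (ℚ.*-zeroˡ τ)) (sym D≡) (fromℤ-pos 0<δ))
  open ≡-Reasoning
  difference : (fromℤ P ℚ.* D ℚ.- N ℚ.* fromℤ Q) ℚ.* τ ≡ fromℤ (P ℤ.* δ ℤ.- Q ℤ.* ν)
  difference = begin
    (fromℤ P ℚ.* D ℚ.- N ℚ.* fromℤ Q) ℚ.* τ
      ≡⟨ solve 5 (λ p d n q t → (p :* d :- n :* q) :* t := p :* (d :* t) :- q :* (n :* t)) refl
           (fromℤ P) D N (fromℤ Q) τ ⟩
    fromℤ P ℚ.* (D ℚ.* τ) ℚ.- fromℤ Q ℚ.* (N ℚ.* τ)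
      ≡⟨ cong₂ (λ x y → fromℤ P ℚ.* x ℚ.- fromℤ Q ℚ.* y) D≡ N≡ ⟩
    fromℤ P ℚ.* fromℤ δ ℚ.- fromℤ Q ℚ.* fromℤ ν
      ≡⟨ cong₂ ℚ._-_ (fromℤ-homo-* P δ) (fromℤ-homo-* Q ν) ⟨
    fromℤ (P ℤ.* δ) ℚ.- fromℤ (Q ℤ.* ν)
      ≡⟨ fromℤ-homo-- (P ℤ.* δ) (Q ℤ.* ν) ⟨
    fromℤ (P ℤ.* δ ℤ.- Q ℤ.* ν) ∎
    where open ℚSolver.+-*-Solver
  0<difference : 0ℚ ℚ.< fromℤ P ℚ.* D ℚ.- N ℚ.* fromℤ Q
  0<difference = ℚ.*-cancelʳ-<-nonNeg τ
    (subst₂ ℚ._<_ (sym (ℚ.*-zeroˡ τ)) (sym difference) (fromℤ-pos 0<Pδ-Qν))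
  NQ<PD : N ℚ.* fromℤ Q ℚ.< fromℤ P ℚ.* D
  NQ<PD = subst₂ ℚ._<_ (ℚ.+-identityˡ (N ℚ.* fromℤ Q))
    (solve 2 (λ x y → x :- y :+ y := x) refl (fromℤ P ℚ.* D) (N ℚ.* fromℤ Q))
    (ℚ.+-monoˡ-< (N ℚ.* fromℤ Q) 0<difference)
    where open ℚSolver.+-*-Solver

scale : ℕ → ℚ
scale m = fromℤ (+ (2 ^ (2 * m)))

d-scale : ∀ i m → d (+ i) m ℚ.* scale m ≡ fromℤ (+ bm i m)
d-scale i m = /-*-cancel (+ bm i m) (2 ^ (2 * m)) {{ℕ.m^n≢0 2 (2 * m)}}

-- bm₋₁ j m is the scaled dⱼ₋₁(m), which is 0 for j = 0.
bm₋₁ : ℕ → ℕ → ℕ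
bm₋₁ zero    m = 0
bm₋₁ (suc j) m = bm j m

d₋₁-scale : ∀ j m → d (+ suc j ℤ.- + 2) m ℚ.* scale m ≡ fromℤ (+ bm₋₁ j m)
d₋₁-scale zero    m = ℚ.*-zeroˡ (scale m)
d₋₁-scale (suc j) m = d-scale j m

bm₋₁-recurrence : ∀ n j {m} → m ≡ suc (suc n) + j →
  let i = + 1 ℤ.+ + j; a = + 2 ℤ.+ + n; s = + 1 ℤ.+ + n ℤ.+ + 2 ℤ.* i in
  (+ 1 ℤ.+ a) ℤ.* (s ℤ.- + 1) ℤ.* + bm₋₁ j m ℤ.+ (i ℤ.- + 1) ℤ.* i ℤ.* + bm (suc j) m
  ≡ (i ℤ.- + 1) ℤ.* (s ℤ.+ a) ℤ.* + bm j m
bm₋₁-recurrence n zero refl = zeros (+ 1 ℤ.+ (+ 2 ℤ.+ + n)) (+ 1 ℤ.+ + n ℤ.+ + 2 ℤ.* + 1 ℤ.- + 1)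
  (+ bm 1 (suc (suc n) + 0)) (+ 1 ℤ.+ + n ℤ.+ + 2 ℤ.* + 1 ℤ.+ (+ 2 ℤ.+ + n)) (+ bm 0 (suc (suc n) + 0))
  where
  zeros : ∀ u v B w A → u ℤ.* v ℤ.* + 0 ℤ.+ + 0 ℤ.* + 1 ℤ.* B ≡ + 0 ℤ.* w ℤ.* A
  zeros = ℤSolver.solve-∀
bm₋₁-recurrence n (suc j) refl = subst₂
  (λ s t → + (3 + n) ℤ.* s ℤ.* + bm j m ℤ.+ + suc j ℤ.* + suc (suc j) ℤ.* + bm (suc (suc j)) m
           ≡ + suc j ℤ.* t ℤ.* + bm (suc j) m)
  (s-1≡ (+ n) (+ j)) (s+a≡ (+ n) (+ j))
  (subst
    (λ m → + (3 + n) ℤ.* + suc (3 + n + j + j) ℤ.* + bm j m ℤ.+ + suc j ℤ.* + suc (suc j) ℤ.* + bm (suc (suc j)) m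
           ≡ + suc j ℤ.* (+ 1 ℤ.+ + 2 ℤ.* + (3 + n + j)) ℤ.* + bm (suc j) m)
    (sym (ℕ.+-suc (2 + n) j)) (bm-recurrence (3 + n) j))
  where
  m = suc (suc n) + suc j
  s-1≡ : ∀ n j → + 1 ℤ.+ (+ 3 ℤ.+ n ℤ.+ j ℤ.+ j) ≡ + 1 ℤ.+ n ℤ.+ + 2 ℤ.* (+ 2 ℤ.+ j) ℤ.- + 1
  s-1≡ = ℤSolver.solve-∀
  s+a≡ : ∀ n j → + 1 ℤ.+ + 2 ℤ.* (+ 3 ℤ.+ n ℤ.+ j) ≡ + 1 ℤ.+ n ℤ.+ + 2 ℤ.* (+ 2 ℤ.+ j) ℤ.+ (+ 2 ℤ.+ n)
  s+a≡ = ℤSolver.solve-∀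

square : ∀ x → x ℤ.^ 2 ≡ x ℤ.* x
square x = cong (x ℤ.*_) (ℤ.*-identityʳ x)

P-in-terms-of-j-n : ∀ {j n i m} → i ≡ + 1 ℤ.+ j → m ≡ + 2 ℤ.+ n ℤ.+ j →
  let i′ = + 1 ℤ.+ j; s = + 1 ℤ.+ n ℤ.+ + 2 ℤ.* i′ in
  (+ 1 ℤ.+ i′) ℤ.* (+ 2 ℤ.+ i′) ℤ.* ((s ℤ.+ + 3) ℤ.* (s ℤ.+ + 3))
  ≡ (i ℤ.+ + 1) ℤ.* (i ℤ.+ + 2) ℤ.* (m ℤ.+ i ℤ.+ + 3) ℤ.^ 2
P-in-terms-of-j-n {j} {n} {i} {m} refl refl =
  trans (ring j n) (cong ((i ℤ.+ + 1) ℤ.* (i ℤ.+ + 2) ℤ.*_) (sym (square (m ℤ.+ i ℤ.+ + 3))))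
  where
  ring : ∀ j n → let i = + 1 ℤ.+ j; m = + 2 ℤ.+ n ℤ.+ j; s = + 1 ℤ.+ n ℤ.+ + 2 ℤ.* i in
    (+ 1 ℤ.+ i) ℤ.* (+ 2 ℤ.+ i) ℤ.* ((s ℤ.+ + 3) ℤ.* (s ℤ.+ + 3))
    ≡ (i ℤ.+ + 1) ℤ.* (i ℤ.+ + 2) ℤ.* ((m ℤ.+ i ℤ.+ + 3) ℤ.* (m ℤ.+ i ℤ.+ + 3))
  ring = ℤSolver.solve-∀

Q-in-terms-of-j-n : ∀ {j n i m} → i ≡ + 1 ℤ.+ j → m ≡ + 2 ℤ.+ n ℤ.+ j →
  let a = + 2 ℤ.+ n; s = + 1 ℤ.+ n ℤ.+ + 2 ℤ.* (+ 1 ℤ.+ j) in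
  a ℤ.* (+ 1 ℤ.+ a) ℤ.* ((s ℤ.+ + 2) ℤ.* (s ℤ.+ + 2))
  ≡ (m ℤ.+ + 1 ℤ.- i) ℤ.* (m ℤ.+ + 2 ℤ.- i) ℤ.* (m ℤ.+ i ℤ.+ + 2) ℤ.^ 2
Q-in-terms-of-j-n {j} {n} {i} {m} refl refl =
  trans (ring j n) (cong ((m ℤ.+ + 1 ℤ.- i) ℤ.* (m ℤ.+ + 2 ℤ.- i) ℤ.*_) (sym (square (m ℤ.+ i ℤ.+ + 2))))
  where
  ring : ∀ j n → let i = + 1 ℤ.+ j; m = + 2 ℤ.+ n ℤ.+ j; a = + 2 ℤ.+ n; s = + 1 ℤ.+ n ℤ.+ + 2 ℤ.* i in
    a ℤ.* (+ 1 ℤ.+ a) ℤ.* ((s ℤ.+ + 2) ℤ.* (s ℤ.+ + 2))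
    ≡ (m ℤ.+ + 1 ℤ.- i) ℤ.* (m ℤ.+ + 2 ℤ.- i) ℤ.* ((m ℤ.+ i ℤ.+ + 2) ℤ.* (m ℤ.+ i ℤ.+ + 2))
  ring = ℤSolver.solve-∀

ratio-bound : ∀ {w p q e τ W A B E j n P Q} →
  let i = + 1 ℤ.+ j
      a = + 2 ℤ.+ n
      s = + 1 ℤ.+ n ℤ.+ + 2 ℤ.* i
      N = p ² ℚ.- w ℚ.* q
      D = q ² ℚ.- p ℚ.* e
  in
  (+ 1 ℤ.+ i) ℤ.* (+ 2 ℤ.+ i) ℤ.* ((s ℤ.+ + 3) ℤ.* (s ℤ.+ + 3)) ≡ P →
  a ℤ.* (+ 1 ℤ.+ a) ℤ.* ((s ℤ.+ + 2) ℤ.* (s ℤ.+ + 2)) ≡ Q →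
  + 0 ℤ.≤ j → + 0 ℤ.≤ n → 0ℚ ℚ.< τ ² →
  w ℚ.* τ ≡ fromℤ W → p ℚ.* τ ≡ fromℤ A → q ℚ.* τ ≡ fromℤ B → e ℚ.* τ ≡ fromℤ E →
  (+ 1 ℤ.+ a) ℤ.* (s ℤ.- + 1) ℤ.* W ℤ.+ (i ℤ.- + 1) ℤ.* i ℤ.* B ≡ (i ℤ.- + 1) ℤ.* (s ℤ.+ a) ℤ.* A →
  a ℤ.* s ℤ.* A ℤ.+ i ℤ.* (+ 1 ℤ.+ i) ℤ.* E ≡ i ℤ.* (s ℤ.+ a) ℤ.* B →
  RatioBounds i a A B → + 0 ℤ.< B →
  Σ[ D≢0 ∈ ℚ.NonZero D ] Σ[ Q≢0 ∈ ℚ.NonZero (fromℤ Q) ]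
    (N ℚ.÷ D) {{D≢0}} ℚ.< (fromℤ P ℚ.÷ fromℤ Q) {{Q≢0}}
ratio-bound {w} {p} {q} {e} {τ} {W} {A} {B} {E} {j} {n} {P} {Q}
    P≡ Q≡ 0≤j 0≤n 0<τ² w≡ p≡ q≡ e≡ rec₁ rec₂ bounds 0<B =
  ratio-fromℤ {p ² ℚ.- w ℚ.* q} {q ² ℚ.- p ℚ.* e} {τ ²} {ν} {δ} {P} {Q} 0<τ²
    (turan-fromℤ {w} {p} {q} {τ} {W} {A} {B} w≡ p≡ q≡)
    (turan-fromℤ {p} {q} {e} {τ} {A} {B} {E} p≡ q≡ e≡)
    (proj₁ turan)
    (subst (+ 0 ℤ.<_) Q≡ 0<Q)
    (subst₂ (λ P Q → + 0 ℤ.< P ℤ.* δ ℤ.- Q ℤ.* ν) P≡ Q≡ (proj₂ turan))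
  where
  ν = A ℤ.* A ℤ.- W ℤ.* B
  δ = B ℤ.* B ℤ.- A ℤ.* E
  turan = turan-bounds {j} {n} {W} {A} {B} {E} 0≤j 0≤n rec₁ rec₂ bounds 0<B
  a = + 2 ℤ.+ n
  s = + 1 ℤ.+ n ℤ.+ + 2 ℤ.* (+ 1 ℤ.+ j)
  0<a : + 0 ℤ.< a
  0<a = ℤ.+-mono-<-≤ (ℤ.+<+ (s≤s z≤n)) 0≤n
  0<s+2 : + 0 ℤ.< s ℤ.+ + 2
  0<s+2 = ℤ.+-mono-≤-< {+ 0} ((0≤+ 1 ⊕ 0≤n) ⊕ 0≤+ 2 ⊗ (0≤+ 1 ⊕ 0≤j)) (ℤ.+<+ (s≤s z≤n))
  0<Q : + 0 ℤ.< a ℤ.* (+ 1 ℤ.+ a) ℤ.* ((s ℤ.+ + 2) ℤ.* (s ℤ.+ + 2))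
  0<Q = 0<*0<⇒0< {a ℤ.* (+ 1 ℤ.+ a)} (0<*0<⇒0< 0<a (ℤ.+-mono-≤-< (0≤+ 1) 0<a)) (0<*0<⇒0< 0<s+2 0<s+2)

0<scale² : ∀ m → 0ℚ ℚ.< scale m ²
0<scale² m = subst (0ℚ ℚ.<_) (fromℤ-homo-* t t) (fromℤ-pos (0<*0<⇒0< 0<t 0<t))
  where
  t = + (2 ^ (2 * m))
  0<t : + 0 ℤ.< t
  0<t = ℤ.+<+ (ℕ.m^n>0 2 (2 * m))

d₊₁-scale : ∀ j m → d (+ suc j ℤ.+ + 1) m ℚ.* scale m ≡ fromℤ (+ bm (suc (suc j)) m)
d₊₁-scale j m = subst (λ k → d (+ k) m ℚ.* scale m ≡ fromℤ (+ bm (suc (suc j)) m))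
  (ℕ.+-comm 1 (suc j)) (d-scale (suc (suc j)) m)

bm-pos : ∀ n j {m} → m ≡ suc n + suc j → + 0 ℤ.< + bm (suc j) m
bm-pos n j refl = RatioBounds.positive (ratio-bounds (suc n) (suc j))

theorem1p6 : (m : ℕ) (i : ℤ) → + 1 ℤ.≤ i → i ℤ.≤ + m ℤ.- + 1 →
    let N = d (i ℤ.- + 1) m ² ℚ.- d (i ℤ.- + 2) m ℚ.* d i m
        D = d i m ² ℚ.- d (i ℤ.- + 1) m ℚ.* d (i ℤ.+ + 1) m
        P = fromℤ ((i ℤ.+ + 1) ℤ.* (i ℤ.+ + 2) ℤ.* (+ m ℤ.+ i ℤ.+ + 3) ℤ.^ 2)
        Q = fromℤ ((+ m ℤ.+ + 1 ℤ.- i) ℤ.* (+ m ℤ.+ + 2 ℤ.- i) ℤ.* (+ m ℤ.+ i ℤ.+ + 2) ℤ.^ 2)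
    in  Σ[ D≢0 ∈ ℚ.NonZero D ] Σ[ Q≢0 ∈ ℚ.NonZero Q ]
          (N ℚ.÷ D) {{D≢0}} ℚ.< (P ℚ.÷ Q) {{Q≢0}}
theorem1p6 m@(suc m′) i@(+ suc j) _ (ℤ.+≤+ j<m′) = ratio-bound
  {d (i ℤ.- + 2) m} {d (i ℤ.- + 1) m} {d i m} {d (i ℤ.+ + 1) m} {scale m}
  {+ bm₋₁ j m} {+ bm j m} {+ bm (suc j) m} {+ bm (suc (suc j)) m}
  (P-in-terms-of-j-n {+ j} {+ n} {i} {+ m} refl (cong +_ m≡)) (Q-in-terms-of-j-n {+ j} {+ n} {i} {+ m} refl (cong +_ m≡))
  (0≤+ j) (0≤+ n) (0<scale² m)
  (d₋₁-scale j m) (d-scale j m) (d-scale (suc j) m) (d₊₁-scale j m)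
  (bm₋₁-recurrence n j m≡) (bm-recurrence′ (suc n) j m≡ refl refl refl)
  (subst (λ m → RatioBounds i (+ suc (suc n)) (+ bm j m) (+ bm (suc j) m)) (sym m≡)
    (ratio-bounds (suc (suc n)) j))
  (bm-pos n j (trans m≡ (sym (ℕ.+-suc (suc n) j))))
  where
  n = m′ ∸ suc j
  m≡ : m ≡ suc (suc n) + j
  m≡ = cong suc (trans (sym (ℕ.m∸n+n≡m j<m′)) (ℕ.+-suc n j))
theorem1p6 m    (+ 0)     (ℤ.+≤+ ()) _
theorem1p6 zero (+ suc j) _          ()
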